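{- With $c_n(k)$ and $\tilde c_n(k)$ ($n,k\ge0$) as defined in the context, the following identities of formal power series in $t$ and $q$ hold: $$\sum_{k,n\ge 0}c_n(k)\,t^kq^n=\frac{1}{(q,tq^2;tq^2)_\infty},\qquad \sum_{k,n\ge0}\tilde c_n(k)\,t^kq^n=\frac{1}{(tq^2,tq^3;tq^2)_\infty}.$$
   Context: A partition of $n$ is a weakly decreasing finite sequence of positive integers with sum $n$; the empty sequence is the only partition of $0$. Meander: given two compositions (or partitions) $\lambda=(\lambda_1,\dots,\lambda_r)$ and $\mu=(\mu_1,\dots,\mu_s)$ of $n$, the meander of type $\frac{\lambda}{\mu}$ is the graph on $n$ vertices placed in a row, with the following edges. Split the row into consecutive blocks of sizes $\lambda_1,\dots,\lambda_r$, and name the vertices of the $i$-th block, in order, $v_{i,1},\dots,v_{i,\lambda_i}$; for each $i$ and each $1\le j\le\lfloor\lambda_i/2\rfloor$ add a "top" edge joining $v_{i,j}$ and $v_{i,\lambda_i+1-j}$. Do the same with $\mu$ in place of $\lambda$ to get "bottom" edges. If a top edge and a bottom edge join the same two vertices, both are kept and they form a cycle (of length 2). Every connected component is a cycle or a path, an isolated vertex being counted as a path. Define $\mathrm{ind}_\mu(\lambda)=2C+P-1$, where $C$ and $P$ are the numbers of cycles and paths of the meander. $\mathrm{ind}_{1^n}(\lambda)$ denotes $\mathrm{ind}_\mu(\lambda)$ with $\mu=1^n=(1,1,\dots,1)$ ($n$ ones); for $n=0$ and $\lambda$ empty it is defined to be $-1$. For $n,k\ge 0$: $c_n(k):=\#\{\lambda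 \text{ partition of } n:\ \mathrm{ind}_{1^n}(\lambda)=n-k-1\}$. Writing $f_i$ for the number of parts of $\lambda$ equal to $i$, $\tilde c_n(k):=\#\{\lambda\text{ partition of }n:\ f_1=0,\ \sum_{i\ge1}i(f_{2i}+f_{2i+1})=k\}$. $q$-series notation: $(a;q)_\infty=\prod_{j\ge0}(1-aq^j)$ and $(a_1,\dots,a_m;q)_\infty=(a_1;q)_\infty\cdots(a_m;q)_\infty$; the entry after the semicolon (here $tq^2$) is the base. -}

module Defs where

import Algebra.Properties.Semiring.Sum
open import Data.Bool.Base using (if_then_else_; true; false; T)
open import Data.Fin.Base as Fin using (Fin; zero; suc; toℕ; opposite; inject≤; cast; _↑ˡ_; _↑ʳ_)
import Data.Fin.Properties as Fin
open import Data.Integer.Base as ℤ using (ℤ; +_; 0ℤ; 1ℤ)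
import Data.Integer.Properties as ℤ
open import Data.List.Base as List using (List; []; _∷_; _++_; length; filter; replicate; tabulate; allFin; applyUpTo; foldr)
open import Data.List.Membership.Propositional using (_∈_)
open import Data.List.Membership.Propositional.Properties using (∈-++⁺ˡ; ∈-++⁺ʳ; ∈-map⁺; ∈-map⁻)
open import Data.List.Properties using (∷-injectiveʳ)
open import Data.List.Relation.Binary.Disjoint.Propositional using (Disjoint)
open import Data.List.Relation.Unary.All as All using (All; []; _∷_)
import Data.List.Relation.Unary.All.Properties as All
open import Data.List.Relation.Unary.AllPairs using ([]; _∷_)
open import Data.List.Relation.Unary.Any as Any using (Any; here; there)
open import Data.List.Relation.Unary.Linked as Linked using (Linked; []; [-]; _∷_)
open import Data.List.Relation.Unary.Unique.Propositional using (Unique)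
import Data.List.Relation.Unary.Unique.Propositional.Properties as Unique
open import Data.Nat.Base using (ℕ; zero; suc; _+_; _*_; _∸_; _≤_; _<_; _≥_; _≤ᵇ_; z≤n; s≤s; z<s; s<s; ⌊_/2⌋)
open import Data.Nat.ListAction using (sum)
open import Data.Nat.Properties as ℕ using (_≟_)
open import Data.Product using (∃; ∃₂; _×_; _,_; proj₁; proj₂)
open import Data.Sum using (_⊎_; inj₁; inj₂)
open import Data.Unit.Base using (⊤; tt)
open import Data.Vec.Base as Vec using (Vec; []; _∷_)
import Data.Vec.Membership.DecPropositional as VecDecMembership
import Data.Vec.Relation.Unary.Unique.Propositional as Vec using (Unique)
import Data.Vec.Relation.Unary.Unique.Propositional.Properties as Vec using (lookup-injective)
import Data.Vec.Relation.Unary.AllPairs as VecAllPairs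
open import Function.Base using (_∘_)
open import Relation.Binary.Construct.Closure.ReflexiveTransitive as Star using (Star; ε; _◅_; _◅◅_)
open import Relation.Binary.PropositionalEquality
open import Relation.Nullary.Decidable using (Dec; yes; no; does; map′; _×-dec_; _⊎-dec_; _→-dec_; ¬?)
open import Relation.Nullary.Negation using (contradiction)
open import Relation.Unary using (Pred; Decidable)

------------------------------------------------------------------------
-- Compositions and partitions

record Composition (n : ℕ) : Set where
  field
    parts    : List ℕ
    positive : All (0 <_) parts
    sum≡n    : sum parts ≡ n

record Partition (n : ℕ) : Set where
  field
    composition : Composition n
  open Composition composition public
  field
    decreasing  : Linked _≥_ parts

open Partition using (composition)

ones : ∀ n → Composition n
ones n = record
  { parts    = replicate n 1
  ; positive = All.replicate⁺ n z<s
  ; sum≡n    = sum-ones n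
  }
  where
  sum-ones : ∀ n → sum (replicate n 1) ≡ n
  sum-ones zero    = refl
  sum-ones (suc n) = cong suc (sum-ones n)

------------------------------------------------------------------------
-- Enumeration of the partitions of n

-- The partitions of n with all parts at most m. The first argument is fuel,
-- which does not run out as long as it is at least n.
bounded : ℕ → ℕ → ℕ → List (List ℕ)
bounded _       _       zero    = [] ∷ []
bounded _       zero    (suc n) = []
bounded zero    (suc m) (suc n) = []
bounded (suc l) (suc m) (suc n) =
  bounded (suc l) m (suc n) ++
  (if m ≤ᵇ n then List.map (suc m ∷_) (bounded l (suc m) (n ∸ m)) else [])

IsBounded : ℕ → ℕ → List ℕ → Set
IsBounded m n xs = All (_≤ m) xs × All (0 <_) xs × Linked _≥_ xs × sum xs ≡ n

private

  cons-linked : ∀ {m xs} → All (_≤ m) xs → Linked _≥_ xs → Linked _≥_ (m ∷ xs)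
  cons-linked []      []  = [-]
  cons-linked (p ∷ _) lnk = p ∷ lnk

  bounded-by-head : ∀ {m xs} → Linked _≥_ (m ∷ xs) → All (_≤ m) xs
  bounded-by-head [-]        = []
  bounded-by-head (p ∷ rest) = p ∷ All.map (λ q → ℕ.≤-trans q p) (bounded-by-head rest)

bounded-sound : ∀ l m n → All (IsBounded m n) (bounded l m n)
bounded-sound _       _       zero    = ([] , [] , [] , refl) ∷ []
bounded-sound _       zero    (suc n) = []
bounded-sound zero    (suc m) (suc n) = []
bounded-sound (suc l) (suc m) (suc n) = All.++⁺
  (All.map (λ (b , r) → All.map ℕ.m≤n⇒m≤1+n b , r) (bounded-sound (suc l) m (suc n)))
  with-part
  where
  with-part : All (IsBounded (suc m) (suc n))
    (if m ≤ᵇ n then List.map (suc m ∷_) (bounded l (suc m) (n ∸ m)) else [])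
  with-part with m ≤ᵇ n in eq
  ... | false = []
  ... | true  = All.map⁺ (All.map
    (λ (b , p , d , s) → ℕ.≤-refl ∷ b , z<s ∷ p , cons-linked b d
                       , cong suc (trans (cong (_+_ m) s) (ℕ.m+[n∸m]≡n (ℕ.≤ᵇ⇒≤ m n (subst T (sym eq) tt)))))
    (bounded-sound l (suc m) (n ∸ m)))

bounded-complete : ∀ l m n {xs} → n ≤ l → IsBounded m n xs → xs ∈ bounded l m n
bounded-complete l m zero {[]} _ _ = here refl
bounded-complete l m zero {suc x ∷ xs} _ (_ , _ , _ , ())
bounded-complete l m zero {zero ∷ xs} _ (_ , () ∷ _ , _)
bounded-complete l m (suc n) {[]} _ (_ , _ , _ , ())
bounded-complete l zero (suc n) {suc x ∷ xs} _ (() ∷ _ , _)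
bounded-complete l zero (suc n) {zero ∷ xs} _ (_ , () ∷ _ , _)
bounded-complete (suc l) (suc m) (suc n) {x ∷ xs} (s≤s n≤l) (b ∷ bs , p ∷ ps , d , s)
  with x ≟ suc m
... | no x≢1+m = ∈-++⁺ˡ (bounded-complete (suc l) m (suc n) (s≤s n≤l)
        (x≤m ∷ All.map (λ q → ℕ.≤-trans q x≤m) (bounded-by-head d) , p ∷ ps , d , s))
  where
  x≤m : x ≤ m
  x≤m = ℕ.≤-pred (ℕ.≤∧≢⇒< b x≢1+m)
... | yes refl with m ≤ᵇ n in eq
...   | true  = ∈-++⁺ʳ (bounded (suc l) m (suc n)) (∈-map⁺ (suc m ∷_)
        (bounded-complete l (suc m) (n ∸ m) (ℕ.≤-trans (ℕ.m∸n≤m n m) n≤l)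
          (bs , ps , Linked.tail d
          , sym (trans (cong (_∸ m) (sym (ℕ.suc-injective s))) (ℕ.m+n∸m≡n m (sum xs))))))
...   | false = contradiction
        (ℕ.≤⇒≤ᵇ (ℕ.≤-trans (ℕ.m≤m+n m (sum xs)) (ℕ.≤-reflexive (ℕ.suc-injective s))))
        (subst T eq)

bounded-unique : ∀ l m n → Unique (bounded l m n)
bounded-unique _       _       zero    = [] ∷ []
bounded-unique _       zero    (suc n) = []
bounded-unique zero    (suc m) (suc n) = []
bounded-unique (suc l) (suc m) (suc n) with m ≤ᵇ n
... | false = Unique.++⁺ (bounded-unique (suc l) m (suc n)) [] (λ ())
... | true  = Unique.++⁺ (bounded-unique (suc l) m (suc n))
                (Unique.map⁺ ∷-injectiveʳ (bounded-unique l (suc m) (n ∸ m)))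
                disjoint
  where
  disjoint : Disjoint (bounded (suc l) m (suc n)) (List.map (suc m ∷_) (bounded l (suc m) (n ∸ m)))
  disjoint (v∈ , v∈′) with ∈-map⁻ (suc m ∷_) v∈′
  ... | _ , _ , refl with All.lookup (bounded-sound (suc l) m (suc n)) v∈
  ...   | 1+m≤m ∷ _ , _ = ℕ.1+n≰n 1+m≤m

toPartition : ∀ {m n xs} → IsBounded m n xs → Partition n
toPartition {xs = xs} (_ , p , d , s) = record
  { composition = record { parts = xs ; positive = p ; sum≡n = s } ; decreasing = d }

partitions : ∀ n → List (Partition n)
partitions n = All.reduce toPartition (bounded-sound n n n)

parts-injective : ∀ {n} {π ρ : Partition n} →
                  Partition.parts π ≡ Partition.parts ρ → π ≡ ρ
parts-injective
  {π = record { composition = record { parts = xs ; positive = p ; sum≡n = s } ; decreasing = d }}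
  {ρ = record { composition = record { positive = p′ ; sum≡n = s′ } ; decreasing = d′ }} refl
  rewrite All.irrelevant ℕ.≤-irrelevant p p′
        | ℕ.≡-irrelevant s s′
        | Linked.irrelevant ℕ.≤-irrelevant d d′ = refl

private
  parts-reduce : ∀ {m n xss} (ps : All (IsBounded m n) xss) →
                 List.map Partition.parts (All.reduce toPartition ps) ≡ xss
  parts-reduce []       = refl
  parts-reduce (_ ∷ ps) = cong (_ ∷_) (parts-reduce ps)

  part≤sum : ∀ xs → All (_≤ sum xs) xs
  part≤sum []       = []
  part≤sum (x ∷ xs) =
    ℕ.m≤m+n x _ ∷ All.map (λ p → ℕ.≤-trans p (ℕ.m≤n+m _ x)) (part≤sum xs)

partitions-parts : ∀ n → List.map Partition.parts (partitions n) ≡ bounded n n n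
partitions-parts n = parts-reduce (bounded-sound n n n)

partitions-complete : ∀ {n} (π : Partition n) → π ∈ partitions n
partitions-complete {n} π
  with ∈-map⁻ Partition.parts (subst (Partition.parts π ∈_) (sym (partitions-parts n))
         (bounded-complete n n n ℕ.≤-refl
           ( subst (λ m → All (_≤ m) (Partition.parts π)) (Partition.sum≡n π) (part≤sum _)
           , Partition.positive π , Partition.decreasing π , Partition.sum≡n π)))
... | ρ , ρ∈ , eq = subst (_∈ partitions n) (sym (parts-injective eq)) ρ∈

partitions-unique : ∀ n → Unique (partitions n)
partitions-unique n =
  Unique.map⁻ (subst Unique (sym (partitions-parts n)) (bounded-unique n n n))

------------------------------------------------------------------------
-- Multigraphs on Fin n

-- Edges are unoriented although they are stored as ordered pairs, and they are
-- identified by their position in the list, so parallel edges are distinct.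
Multigraph : ℕ → Set
Multigraph n = List (Fin n × Fin n)

module _ {n : ℕ} where

  Joins : Fin n × Fin n → Fin n → Fin n → Set
  Joins e u v = (e ≡ (u , v)) ⊎ (e ≡ (v , u))

  Adjacent : Multigraph n → Fin n → Fin n → Set
  Adjacent G u v = Any (λ e → Joins e u v) G

  Connected : Multigraph n → Fin n → Fin n → Set
  Connected G = Star (Adjacent G)

  open VecDecMembership (Fin._≟_ {n}) using () renaming (_∈_ to _∈ᵥ_)

  module _ (G : Multigraph n) where

    Edge : Set
    Edge = Fin (length G)

    open VecDecMembership (Fin._≟_ {length G}) using () renaming (_∈_ to _∈ₑ_)

    -- Starting at u, the edges es lead successively to the vertices vs.
    Route : ∀ {m} → Fin n → Vec Edge m → Vec (Fin n) m → Set
    Route u []       []       = ⊤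
    Route u (e ∷ es) (v ∷ vs) = Joins (List.lookup G e) u v × Route v es vs

    -- The component of w has vertex set vs, and all its edges are among es.
    -- (An edge with one end in a component has both ends in it.)
    Exhausts : ∀ {l m} → Fin n → Vec (Fin n) l → Vec Edge m → Set
    Exhausts w vs es =
      (∀ v → (Connected G w v → v ∈ᵥ vs) × (v ∈ᵥ vs → Connected G w v)) ×
      (∀ e → proj₁ (List.lookup G e) ∈ᵥ vs → e ∈ₑ es)

    PathOn : Fin n → ∀ {m} → Fin n → Vec (Fin n) m → Vec Edge m → Set
    PathOn w u vs es =
      Route u es vs × Vec.Unique (u ∷ vs) × Vec.Unique es × Exhausts w (u ∷ vs) es

    CycleOn : Fin n → ∀ {m} → Vec (Fin n) (suc m) → Vec Edge (suc m) → Set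
    CycleOn w vs es =
      Route (Vec.last vs) es vs × Vec.Unique vs × Vec.Unique es × Exhausts w vs es

    -- The component of w is a path, possibly a single vertex.
    InPath : Fin n → Set
    InPath w = ∃ λ m → ∃ λ u → ∃₂ λ (vs : Vec _ m) es → PathOn w u vs es

    -- The component of w is a cycle, possibly of length 2 (or a loop, but
    -- meanders have none).
    InCycle : Fin n → Set
    InCycle w = ∃ λ m → ∃₂ λ (vs : Vec _ (suc m)) es → CycleOn w vs es

    -- Components are counted by their least vertices.
    Least : Fin n → Set
    Least w = ∀ v → Connected G w v → w Fin.≤ v

------------------------------------------------------------------------
-- Decidability of the notions above

private

  vec-any? : ∀ {k m p} {P : Pred (Vec (Fin k) m) p} → Decidable P → Dec (∃ P)
  vec-any? {m = zero} P? = map′ (λ p → [] , p) (λ { ([] , p) → p }) (P? [])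
  vec-any? {m = suc m} P? =
    map′ (λ { (x , xs , p) → x ∷ xs , p }) (λ { (x ∷ xs , p) → x , xs , p })
      (Fin.any? (λ x → vec-any? (λ xs → P? (x ∷ xs))))

  unique? : ∀ {k m} → Decidable (Vec.Unique {A = Fin k} {n = m})
  unique? = VecAllPairs.allPairs? (λ x y → ¬? (x Fin.≟ y))

  unique⇒≤ : ∀ {k m} {xs : Vec (Fin k) m} → Vec.Unique xs → m ≤ k
  unique⇒≤ {xs = xs} u =
    Fin.injective⇒≤ {f = Vec.lookup xs} (λ {i} {j} → Vec.lookup-injective u i j)

  bounded-any? : ∀ {p} {P : Pred ℕ p} k → (∀ {m} → P m → m < k) → Decidable P → Dec (∃ P)
  bounded-any? {P = P} k bound P? =
    map′ (λ (i , p) → toℕ i , p)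
         (λ (m , p) → Fin.fromℕ< (bound p) , subst P (sym (Fin.toℕ-fromℕ< (bound p))) p)
         (Fin.any? {n = k} (P? ∘ toℕ))

module _ {n : ℕ} where

  joins? : ∀ e u v → Dec (Joins {n} e u v)
  joins? (a , b) u v = pair? u v ⊎-dec pair? v u
    where
    pair? : ∀ u v → Dec ((a , b) ≡ (u , v))
    pair? u v = map′ (λ { (refl , refl) → refl }) (λ { refl → refl , refl })
                     (a Fin.≟ u ×-dec b Fin.≟ v)

  connected? : ∀ (G : Multigraph n) u v → Dec (Connected G u v)
  connected? []            u v = map′ (λ { refl → ε }) (λ { ε → refl }) (u Fin.≟ v)
  connected? ((a , b) ∷ G) u v = map′ to from
    (connected? G u v
      ⊎-dec (connected? G u a ×-dec connected? G b v)
      ⊎-dec (connected? G u b ×-dec connected? G a v))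
    where
    Via : Fin n → Set
    Via u = Connected G u v
          ⊎ (Connected G u a × Connected G b v)
          ⊎ (Connected G u b × Connected G a v)

    weaken : ∀ {x y} → Connected G x y → Connected ((a , b) ∷ G) x y
    weaken = Star.map there

    to : Via u → Connected ((a , b) ∷ G) u v
    to (inj₁ p)              = weaken p
    to (inj₂ (inj₁ (p , q))) = weaken p ◅◅ here (inj₁ refl) ◅ weaken q
    to (inj₂ (inj₂ (p , q))) = weaken p ◅◅ here (inj₂ refl) ◅ weaken q

    step : ∀ {x y} → Adjacent ((a , b) ∷ G) x y → Via y → Via x
    step (here (inj₁ refl)) (inj₁ p)              = inj₂ (inj₁ (ε , p))
    step (here (inj₁ refl)) (inj₂ (inj₁ (_ , q))) = inj₂ (inj₁ (ε , q))
    step (here (inj₁ refl)) (inj₂ (inj₂ (_ , q))) = inj₁ q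
    step (here (inj₂ refl)) (inj₁ p)              = inj₂ (inj₂ (ε , p))
    step (here (inj₂ refl)) (inj₂ (inj₁ (_ , q))) = inj₁ q
    step (here (inj₂ refl)) (inj₂ (inj₂ (_ , q))) = inj₂ (inj₂ (ε , q))
    step (there s)          (inj₁ p)              = inj₁ (s ◅ p)
    step (there s)          (inj₂ (inj₁ (p , q))) = inj₂ (inj₁ (s ◅ p , q))
    step (there s)          (inj₂ (inj₂ (p , q))) = inj₂ (inj₂ (s ◅ p , q))

    from : ∀ {x} → Connected ((a , b) ∷ G) x v → Via x
    from ε        = inj₁ ε
    from (s ◅ ss) = step s (from ss)

  open VecDecMembership (Fin._≟_ {n}) using () renaming (_∈?_ to _∈ᵥ?_)

  module _ (G : Multigraph n) where

    open VecDecMembership (Fin._≟_ {length G}) using () renaming (_∈?_ to _∈ₑ?_)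

    route? : ∀ {m} u es vs → Dec (Route G {m} u es vs)
    route? u []       []       = yes tt
    route? u (e ∷ es) (v ∷ vs) = joins? (List.lookup G e) u v ×-dec route? v es vs

    exhausts? : ∀ {l m} w vs es → Dec (Exhausts G {l} {m} w vs es)
    exhausts? w vs es =
      Fin.all? (λ v → (connected? G w v →-dec v ∈ᵥ? vs) ×-dec (v ∈ᵥ? vs →-dec connected? G w v))
      ×-dec Fin.all? (λ e → proj₁ (List.lookup G e) ∈ᵥ? vs →-dec e ∈ₑ? es)

    inPath? : Decidable (InPath G)
    inPath? w = bounded-any? n (λ (_ , _ , _ , _ , uniq , _) → unique⇒≤ uniq) λ m →
      Fin.any? λ u → vec-any? λ vs → vec-any? λ es →
        route? u es vs ×-dec unique? (u ∷ vs) ×-dec unique? es ×-dec exhausts? w (u ∷ vs) es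

    inCycle? : Decidable (InCycle G)
    inCycle? w = bounded-any? n (λ (_ , _ , _ , uniq , _) → unique⇒≤ uniq) λ m →
      vec-any? λ vs → vec-any? λ es →
        route? (Vec.last vs) es vs ×-dec unique? vs ×-dec unique? es ×-dec exhausts? w vs es

    least? : Decidable (Least G)
    least? w = Fin.all? (λ v → connected? G w v →-dec w Fin.≤? v)

    #paths : ℕ
    #paths = length (filter (λ w → least? w ×-dec inPath? w) (allFin n))

    #cycles : ℕ
    #cycles = length (filter (λ w → least? w ×-dec inCycle? w) (allFin n))

------------------------------------------------------------------------
-- Meanders and their index

mapEdges : ∀ {m n} → (Fin m → Fin n) → Multigraph m → Multigraph n
mapEdges f = List.map (λ (u , v) → f u , f v)

-- The position opposite to the j-th one (from 0) in a block of size a is a ∸ 1 ∸ j.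
blockArcs : ∀ a → Multigraph a
blockArcs a = tabulate {n = ⌊ a /2⌋} λ j →
  let v = inject≤ j (ℕ.⌊n/2⌋≤n a) in v , opposite v

arcs : ∀ as → Multigraph (sum as)
arcs []       = []
arcs (a ∷ as) = mapEdges (_↑ˡ sum as) (blockArcs a) ++ mapEdges (a ↑ʳ_) (arcs as)

meander : ∀ {n} → (λ′ μ : Composition n) → Multigraph n
meander λ′ μ = edges λ′ ++ edges μ
  where
  edges : ∀ {n} → Composition n → Multigraph n
  edges α = mapEdges (cast sum≡n) (arcs parts) where open Composition α

-- For n = 0 there are no components and the index is the conventional -1.
ind : ∀ {n} → (μ λ′ : Composition n) → ℤ
ind μ λ′ = + 2 ℤ.* + #cycles (meander λ′ μ) ℤ.+ + #paths (meander λ′ μ) ℤ.- 1ℤ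

------------------------------------------------------------------------
-- The two counting functions

c : ℕ → ℕ → ℕ
c n k = length (filter
  (λ π → ind (ones n) (composition π) ℤ.≟ + n ℤ.- + k ℤ.- 1ℤ) (partitions n))

mult : ∀ {n} → Partition n → ℕ → ℕ
mult π i = length (filter (i ≟_) (Partition.parts π))

-- The terms with i > n of the sum over all i ≥ 1 vanish.
weight : ∀ {n} → Partition n → ℕ
weight {n} π = sum (applyUpTo (λ j → let i = suc j in
  i * (mult π (2 * i) + mult π (2 * i + 1))) n)

c̃ : ℕ → ℕ → ℕ
c̃ n k = length (filter (λ π → (mult π 1 ≟ 0) ×-dec (weight π ≟ k)) (partitions n))

------------------------------------------------------------------------
-- Formal power series in t and q

-- F k n is the coefficient of t ^ k * q ^ n.
Series : Set
Series = ℕ → ℕ → ℤ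

infix  4 _≈_
infixl 6 _⊖_
infixl 7 _⊛_
infixr 8 _^^_

_≈_ : Series → Series → Set
F ≈ G = ∀ k n → F k n ≡ G k n

open Algebra.Properties.Semiring.Sum ℤ.+-*-semiring
  using (sum⁺-syntax; sum-cong-≗; sum-replicate-zero) renaming (sum to sumℤ)

monomial : ℕ → ℕ → Series
monomial i j k n = if does ((k ≟ i) ×-dec (n ≟ j)) then 1ℤ else 0ℤ

one : Series
one = monomial 0 0

_⊖_ : Series → Series → Series
(F ⊖ G) k n = F k n ℤ.- G k n

_⊛_ : Series → Series → Series
(F ⊛ G) k n =
  ∑[ i ≤ k ] (∑[ j ≤ n ] (F (toℕ i) (toℕ j) ℤ.* G (k ∸ toℕ i) (n ∸ toℕ j)))

_^^_ : Series → ℕ → Series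
F ^^ zero  = one
F ^^ suc m = F ⊛ F ^^ m

_IsReciprocalOf_ : Series → Series → Set
F IsReciprocalOf G = F ⊛ G ≈ one

-- The product of 1 - a b ^ j over j < N.
finitePochhammer : Series → Series → ℕ → Series
finitePochhammer a b zero    = one
finitePochhammer a b (suc N) = (one ⊖ a ⊛ b ^^ N) ⊛ finitePochhammer a b N

-- When b has no constant term, the coefficient at t ^ k * q ^ n of the partial
-- products no longer changes once they have more than k + n factors; see
-- pochhammer-converges below.
pochhammer : Series → Series → Series
pochhammer a b k n = finitePochhammer a b (suc (k + n)) k n

-- ⟨ a₁ ∷ … ∷ aₘ ∷ [] ⨾ b ⟩∞ is (a₁, …, aₘ; b)_∞.
⟨_⨾_⟩∞ : List Series → Series → Series
⟨ as ⨾ b ⟩∞ = foldr (λ a F → pochhammer a b ⊛ F) one as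

_ConvergesTo_ : (ℕ → Series) → Series → Set
P ConvergesTo F = ∀ k n → ∃ λ N₀ → ∀ N → N₀ ≤ N → P N k n ≡ F k n

private

  sum-zero : ∀ {m} (f : Fin m → ℤ) → (∀ i → f i ≡ 0ℤ) → sumℤ f ≡ 0ℤ
  sum-zero {m} f f≡0 = trans (sum-cong-≗ f≡0) (sum-replicate-zero m)

  shift≤ : ∀ k n (i : Fin (suc k)) (j : Fin (suc n)) → (k ∸ toℕ i) + (n ∸ toℕ j) ≤ k + n
  shift≤ k n i j = ℕ.+-mono-≤ (ℕ.m∸n≤m k (toℕ i)) (ℕ.m∸n≤m n (toℕ j))

  VanishesBelow : ℕ → Series → Set
  VanishesBelow d F = ∀ k n → k + n < d → F k n ≡ 0ℤ

  ⊛-vanishes : ∀ {d} F {G} → VanishesBelow d G → VanishesBelow d (F ⊛ G)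
  ⊛-vanishes F v k n k+n<d = sum-zero _ λ i → sum-zero _ λ j →
    trans (cong (F (toℕ i) (toℕ j) ℤ.*_)
             (v (k ∸ toℕ i) (n ∸ toℕ j) (ℕ.≤-<-trans (shift≤ k n i j) k+n<d)))
          (ℤ.*-zeroʳ (F (toℕ i) (toℕ j)))

  ⊛-vanishes-suc : ∀ {d} F {G} → F 0 0 ≡ 0ℤ → VanishesBelow d G → VanishesBelow (suc d) (F ⊛ G)
  ⊛-vanishes-suc {d} F {G} F00 v k n k+n<1+d = sum-zero _ λ i → sum-zero _ (term i)
    where
    zeroʳ : ∀ (i : Fin (suc k)) (j : Fin (suc n)) → (k ∸ toℕ i) + (n ∸ toℕ j) < d →
            F (toℕ i) (toℕ j) ℤ.* G (k ∸ toℕ i) (n ∸ toℕ j) ≡ 0ℤ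
    zeroʳ i j lt = trans (cong (F i′ j′ ℤ.*_) (v (k ∸ i′) (n ∸ j′) lt)) (ℤ.*-zeroʳ (F i′ j′))
      where
      i′ = toℕ i
      j′ = toℕ j

    term : ∀ (i : Fin (suc k)) (j : Fin (suc n)) →
           F (toℕ i) (toℕ j) ℤ.* G (k ∸ toℕ i) (n ∸ toℕ j) ≡ 0ℤ
    term zero zero = trans (cong (ℤ._* G k n) F00) (ℤ.*-zeroˡ (G k n))
    term (suc i) j = zeroʳ (suc i) j (ℕ.<-≤-trans
      (ℕ.+-mono-<-≤ (drop k i) (ℕ.m∸n≤m n (toℕ j))) (ℕ.≤-pred k+n<1+d))
      where
      drop : ∀ k (i : Fin k) → k ∸ suc (toℕ i) < k
      drop (suc k) i = s≤s (ℕ.m∸n≤m k (toℕ i))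
    term zero (suc j) = zeroʳ zero (suc j) (ℕ.<-≤-trans
      (ℕ.+-mono-≤-< (ℕ.≤-refl {k}) (drop n j)) (ℕ.≤-pred k+n<1+d))
      where
      drop : ∀ n (j : Fin n) → n ∸ suc (toℕ j) < n
      drop (suc n) j = s≤s (ℕ.m∸n≤m n (toℕ j))

  ^^-vanishes : ∀ b → b 0 0 ≡ 0ℤ → ∀ N → VanishesBelow N (b ^^ N)
  ^^-vanishes b b00 zero    k n ()
  ^^-vanishes b b00 (suc N) = ⊛-vanishes-suc b b00 (^^-vanishes b b00 N)

  agrees-with-one : ∀ {d} F {G} → (∀ k n → k + n < d → F k n ≡ one k n) →
                    ∀ k n → k + n < d → (F ⊛ G) k n ≡ G k n
  agrees-with-one {d} F {G} F≡1 k n k+n<d =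
    trans (cong₂ ℤ._+_ first-row other-rows) (ℤ.+-identityʳ _)
    where
    F≡1′ : ∀ (i : Fin (suc k)) (j : Fin (suc n)) → F (toℕ i) (toℕ j) ≡ one (toℕ i) (toℕ j)
    F≡1′ i j = F≡1 (toℕ i) (toℕ j) (ℕ.≤-<-trans
      (ℕ.+-mono-≤ (ℕ.≤-pred (Fin.toℕ<n i)) (ℕ.≤-pred (Fin.toℕ<n j))) k+n<d)

    first-row : ∑[ j ≤ n ] (F 0 (toℕ j) ℤ.* G k (n ∸ toℕ j)) ≡ G k n
    first-row = trans (cong₂ ℤ._+_
        (trans (cong (ℤ._* G k n) (F≡1′ zero zero)) (ℤ.*-identityˡ (G k n)))
        (sum-zero _ λ j → trans (cong (ℤ._* G k (n ∸ toℕ (Fin.suc j))) (F≡1′ zero (suc j)))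
                                (ℤ.*-zeroˡ (G k (n ∸ toℕ (Fin.suc j))))))
      (ℤ.+-identityʳ _)

    other-rows : sumℤ (λ (i : Fin k) → ∑[ j ≤ n ]
      (F (suc (toℕ i)) (toℕ j) ℤ.* G (k ∸ suc (toℕ i)) (n ∸ toℕ j))) ≡ 0ℤ
    other-rows = sum-zero _ λ i → sum-zero _ λ j →
      trans (cong (ℤ._* G (k ∸ suc (toℕ i)) (n ∸ toℕ j)) (F≡1′ (suc i) j))
            (ℤ.*-zeroˡ (G (k ∸ suc (toℕ i)) (n ∸ toℕ j)))

finitePochhammer-stable : ∀ a b → b 0 0 ≡ 0ℤ → ∀ N k n → k + n < N →
  finitePochhammer a b (suc N) k n ≡ finitePochhammer a b N k n
finitePochhammer-stable a b b00 N = agrees-with-one (one ⊖ a ⊛ b ^^ N) λ k n lt →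
  trans (cong (λ z → one k n ℤ.- z) (⊛-vanishes a (^^-vanishes b b00 N) k n lt))
        (ℤ.+-identityʳ (one k n))

pochhammer-converges : ∀ a b → b 0 0 ≡ 0ℤ →
  finitePochhammer a b ConvergesTo pochhammer a b
pochhammer-converges a b b00 k n = suc (k + n) , λ N le → go (ℕ.≤⇒≤′ le)
  where
  open import Data.Nat.Base using (_≤′_; ≤′-reflexive; ≤′-step)
  go : ∀ {N} → suc (k + n) ≤′ N → finitePochhammer a b N k n ≡ pochhammer a b k n
  go (≤′-reflexive refl) = refl
  go (≤′-step le) =
    trans (finitePochhammer-stable a b b00 _ k n (ℕ.≤′⇒≤ le)) (go le)

-- The sum of a n k * t ^ k * q ^ n over all k and n.
generatingSeries : (ℕ → ℕ → ℕ) → Series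
generatingSeries a k n = + a n k

q tq² tq³ : Series
q   = monomial 0 1
tq² = monomial 1 2
tq³ = monomial 1 3

{-# OPTIONS --safe #-}

-- The blocks of size 1 carry no arcs, so the meander is a matching with
-- Σ ⌊λᵢ/2⌋ edges: it has no cycles and n - Σ ⌊λᵢ/2⌋ paths, and c n k counts the
-- partitions of n with Σ ⌊λᵢ/2⌋ = k. Likewise Σ i (f₂ᵢ + f₂ᵢ₊₁) = Σ ⌊λᵢ/2⌋, so
-- c̃ n k counts those without parts equal to 1. A part m thus contributes the
-- factor 1 / (1 - t^⌊m/2⌋ q^m). Since t^N q^(2N+1) = q (tq²)^N,
-- t^(N+1) q^(2N+2) = tq² (tq²)^N and t^(N+1) q^(2N+3) = tq³ (tq²)^N, the odd and
-- the even m each form one infinite Pochhammer product in base tq².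

module Submission where

open import Defs
import Algebra.Construct.Pointwise as Pointwise
import Algebra.Properties.CommutativeSemigroup
import Algebra.Properties.Group
import Algebra.Properties.Semiring.Sum
open import Algebra.Bundles using (AbelianGroup; CommutativeMonoid; CommutativeSemiring)
open import Algebra.Structures.Biased using (IsCommutativeMonoidˡ; IsCommutativeSemiringˡ)
open import Data.Bool.Base using (if_then_else_; true; false; T)
open import Data.Bool.Properties using (∧-zeroʳ)
open import Data.Fin.Base as Fin using (Fin; zero; suc; toℕ; opposite; inject≤; cast; _↑ˡ_; _↑ʳ_)
import Data.Fin.Properties as Fin
open import Data.Integer.Base as ℤ using (ℤ; +_; 0ℤ; 1ℤ)
import Data.Integer.Properties as ℤ
open import Data.List.Base as List using (List; []; _∷_; _++_; length; filter; replicate; allFin; map; applyUpTo)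
import Data.List.Membership.DecPropositional as DecMembership
open import Data.List.Membership.Propositional using (_∈_; _∉_; lose)
open import Data.List.Membership.Propositional.Properties using (∈-++⁺ˡ; ∈-++⁺ʳ; ∈-allFin; ∈-filter⁺; ∈-filter⁻; ∈-lookup; ∈-map⁺; ∈-map⁻)
open import Data.List.Membership.Propositional.Properties.WithK using (unique∧set⇒bag)
open import Data.List.Properties using (++-identityʳ; filter-++; filter-none; filter-≐; length-++; length-map; length-tabulate)
open import Data.List.Relation.Binary.BagAndSetEquality using (∼bag⇒↭)
open import Data.List.Relation.Binary.Permutation.Propositional.Properties using (↭-length)
open import Data.List.Relation.Unary.All as All using (All; []; _∷_)
import Data.List.Relation.Unary.All.Properties as All
open import Data.List.Relation.Unary.AllPairs as AllPairs using (AllPairs; []; _∷_)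
import Data.List.Relation.Unary.AllPairs.Properties as AllPairs
open import Data.List.Relation.Unary.Any as Any using (Any)
open import Data.List.Relation.Unary.Any.Properties using (lookup-index)
open import Data.List.Relation.Unary.Unique.Propositional using (Unique)
import Data.List.Relation.Unary.Unique.Propositional.Properties as Unique
open import Data.Nat.Base using (ℕ; zero; suc; _+_; _*_; _∸_; _≤_; _<_; _≤ᵇ_; z≤n; s≤s; ⌊_/2⌋; ⌈_/2⌉; _≤′_; ≤′-reflexive; ≤′-step)
open import Data.Nat.ListAction using (sum)
import Data.Nat.Properties as ℕ
open import Data.Product using (_×_; _,_; proj₁; proj₂)
open import Data.Sum using (_⊎_; inj₁; inj₂; swap)
open import Data.Unit.Base using (tt)
open import Data.Vec.Base using ([]; _∷_)
open import Data.Vec.Relation.Unary.All using ([]; _∷_)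
open import Data.Vec.Relation.Unary.AllPairs using ([]; _∷_)
open import Data.Vec.Relation.Unary.Any using (here; there)
open import Function.Base using (_∘_)
open import Function.Bundles using (mk⇔)
open import Level using (Level; 0ℓ)
open import Relation.Binary.Construct.Closure.ReflexiveTransitive using (ε; _◅_)
open import Relation.Binary.Definitions using (tri<; tri≈; tri>)
open import Relation.Binary.PropositionalEquality
import Relation.Binary.Reasoning.Setoid as SetoidReasoning
open import Relation.Nullary.Decidable using (does; yes; no; _×-dec_)
open import Relation.Nullary.Negation using (¬_; contradiction)
open import Relation.Unary using (Pred; Decidable; _≐_)

open Algebra.Properties.CommutativeSemigroup ℕ.+-commutativeSemigroup
  using () renaming (interchange to +-interchange)

-- Bivariate power series

-- No series is inverted. Multiplying the count of partitions with parts in (s , m] by 1 - t^⌊m/2⌋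
-- q^m forbids the part m, so a finite product of such factors cancels one part size after another
-- until only the empty partition is left. Infinite products enter one coefficient at a time: at t^k
-- q^n the counting series and the Pochhammer products all agree with sufficiently long truncations.
-- Reordering the factors needs the commutative monoid laws of `_⊛_`, which is a double sum; they
-- are inherited from power series over an arbitrary commutative semiring, a construction applied
-- twice so that no double sum has to be rearranged.

module PowerSeries {c ℓ : Level} (R : CommutativeSemiring c ℓ) where

  private
    module R = CommutativeSemiring R
    open Algebra.Properties.Semiring.Sum R.semiring
      using (sum⁺-syntax; sum-cong-≋; sum-replicate-zero; *-distribˡ-sum)
      renaming (sum to sumᴿ)
    open Algebra.Properties.CommutativeSemigroup R.+-commutativeSemigroup using (interchange)
    module ≈ = SetoidReasoning R.setoid

  PS : Set c
  PS = ℕ → R.Carrier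

  infix  4 _≋_
  infixl 6 _⊞_
  infixl 7 _✶_
  infixr 7 _•_

  _≋_ : PS → PS → Set ℓ
  f ≋ g = ∀ n → f n R.≈ g n

  _⊞_ _✶_ : PS → PS → PS
  (f ⊞ g) n = f n R.+ g n
  (f ✶ g) n = ∑[ i ≤ n ] (f (toℕ i) R.* g (n ∸ toℕ i))

  _•_ : R.Carrier → PS → PS
  (x • f) n = x R.* f n

  ∅ ι : PS
  ∅ _ = R.0#
  ι zero    = R.1#
  ι (suc _) = R.0#

  -- By computation (f ✶ g) (suc n) is f 0 * g (suc n) + ((f ∘ suc) ✶ g) n, which
  -- is what the inductions on n below use.
  ✶-cong : ∀ {f f′ g g′} → f ≋ f′ → g ≋ g′ → f ✶ g ≋ f′ ✶ g′
  ✶-cong p r n = sum-cong-≋ {suc n} λ i → R.*-cong (p (toℕ i)) (r (n ∸ toℕ i))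

  ✶-zeroˡ : ∀ g → ∅ ✶ g ≋ ∅
  ✶-zeroˡ g n = R.trans (sum-cong-≋ {suc n} λ i → R.zeroˡ (g (n ∸ toℕ i)))
                        (sum-replicate-zero (suc n))

  ✶-identityˡ : ∀ g → ι ✶ g ≋ g
  ✶-identityˡ g zero    = R.trans (R.+-identityʳ _) (R.*-identityˡ _)
  ✶-identityˡ g (suc n) = R.trans
    (R.+-cong (R.*-identityˡ _) (✶-zeroˡ g n)) (R.+-identityʳ _)

  ✶-distribʳ : ∀ h f g → (f ⊞ g) ✶ h ≋ (f ✶ h) ⊞ (g ✶ h)
  ✶-distribʳ h f g zero    = R.trans (R.+-identityʳ _)
    (R.trans (R.distribʳ _ _ _) (R.sym (R.+-cong (R.+-identityʳ _) (R.+-identityʳ _))))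
  ✶-distribʳ h f g (suc n) = R.trans
    (R.+-cong (R.distribʳ _ _ _) (✶-distribʳ h (f ∘ suc) (g ∘ suc) n)) (interchange _ _ _ _)

  •-✶ : ∀ x f g → (x • f) ✶ g ≋ x • (f ✶ g)
  •-✶ x f g n = R.trans (sum-cong-≋ {suc n} λ i → R.*-assoc x (f (toℕ i)) (g (n ∸ toℕ i)))
    (R.sym (*-distribˡ-sum {suc n} x (λ i → f (toℕ i) R.* g (n ∸ toℕ i))))

  -- The counterpart of the computational unfolding: the last term is split off instead of the
  -- first. Exchanging the two unfoldings is what makes commutativity an induction on `n`.
  ✶-suc : ∀ f g n → (f ✶ g) (suc n) R.≈ (f ✶ (g ∘ suc)) n R.+ f (suc n) R.* g 0
  ✶-suc f g zero    = ≈.begin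
    f 0 R.* g 1 R.+ (f 1 R.* g 0 R.+ R.0#)  ≈.≈⟨ R.+-congˡ (R.+-identityʳ _) ⟩
    f 0 R.* g 1 R.+ f 1 R.* g 0             ≈.≈⟨ R.+-congʳ (R.+-identityʳ _) ⟨
    f 0 R.* g 1 R.+ R.0# R.+ f 1 R.* g 0    ≈.∎
  ✶-suc f g (suc n) = R.trans (R.+-congˡ (✶-suc (f ∘ suc) g n)) (R.sym (R.+-assoc _ _ _))

  ✶-comm : ∀ f g → f ✶ g ≋ g ✶ f
  ✶-comm f g zero    = R.+-congʳ (R.*-comm (f 0) (g 0))
  ✶-comm f g (suc n) = ≈.begin
    (f ✶ g) (suc n)                               ≈.≈⟨ ✶-suc f g n ⟩
    (f ✶ (g ∘ suc)) n R.+ f (suc n) R.* g 0       ≈.≈⟨ R.+-cong (✶-comm f (g ∘ suc) n) (R.*-comm _ _) ⟩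
    ((g ∘ suc) ✶ f) n R.+ g 0 R.* f (suc n)       ≈.≈⟨ R.+-comm _ _ ⟩
    (g ✶ f) (suc n)                               ≈.∎

  ✶-assoc : ∀ f g h → (f ✶ g) ✶ h ≋ f ✶ (g ✶ h)
  ✶-assoc f g h zero    = ≈.begin
    (f 0 R.* g 0 R.+ R.0#) R.* h 0 R.+ R.0#    ≈.≈⟨ R.+-congʳ (R.*-congʳ (R.+-identityʳ _)) ⟩
    f 0 R.* g 0 R.* h 0 R.+ R.0#               ≈.≈⟨ R.+-congʳ (R.*-assoc _ _ _) ⟩
    f 0 R.* (g 0 R.* h 0) R.+ R.0#             ≈.≈⟨ R.+-congʳ (R.*-congˡ (R.+-identityʳ _)) ⟨
    f 0 R.* (g 0 R.* h 0 R.+ R.0#) R.+ R.0#    ≈.∎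
  ✶-assoc f g h (suc n) = ≈.begin
    -- By computation the tail of `f ✶ g` is `(f 0 • (g ∘ suc)) ⊞ ((f ∘ suc) ✶ g)`, so the induction
    -- hypothesis is applied to `f ∘ suc`.
    (f 0 R.* g 0 R.+ R.0#) R.* h (suc n) R.+ (((f 0 • (g ∘ suc)) ⊞ ((f ∘ suc) ✶ g)) ✶ h) n
      ≈.≈⟨ R.+-cong (R.*-congʳ (R.+-identityʳ _))
                    (✶-distribʳ h (f 0 • (g ∘ suc)) ((f ∘ suc) ✶ g) n) ⟩
    f 0 R.* g 0 R.* h (suc n) R.+ (((f 0 • (g ∘ suc)) ✶ h) n R.+ (((f ∘ suc) ✶ g) ✶ h) n)
      ≈.≈⟨ R.+-cong (R.*-assoc _ _ _)
             (R.+-cong (•-✶ (f 0) (g ∘ suc) h n) (✶-assoc (f ∘ suc) g h n)) ⟩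
    f 0 R.* (g 0 R.* h (suc n)) R.+ (f 0 R.* ((g ∘ suc) ✶ h) n R.+ ((f ∘ suc) ✶ (g ✶ h)) n)
      ≈.≈⟨ R.+-assoc _ _ _ ⟨
    f 0 R.* (g 0 R.* h (suc n)) R.+ f 0 R.* ((g ∘ suc) ✶ h) n R.+ ((f ∘ suc) ✶ (g ✶ h)) n
      ≈.≈⟨ R.+-congʳ (R.distribˡ _ _ _) ⟨
    f 0 R.* (g ✶ h) (suc n) R.+ ((f ∘ suc) ✶ (g ✶ h)) n ≈.∎

  ✶-zero-head : ∀ f g → f 0 R.≈ R.0# → (f ✶ g) 0 R.≈ R.0#
  ✶-zero-head f g f0≈0 = R.trans (R.+-identityʳ _) (R.trans (R.*-congʳ f0≈0) (R.zeroˡ _))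

  ✶-tail : ∀ f g n → f 0 R.≈ R.0# → (f ✶ g) (suc n) R.≈ ((f ∘ suc) ✶ g) n
  ✶-tail f g n f0≈0 = R.trans (R.+-congʳ (R.trans (R.*-congʳ f0≈0) (R.zeroˡ _))) (R.+-identityˡ _)

  ✶-constant : ∀ f g n → f ∘ suc ≋ ∅ → (f ✶ g) n R.≈ f 0 R.* g n
  ✶-constant f g zero    f′≋0 = R.+-identityʳ _
  ✶-constant f g (suc n) f′≋0 = R.trans
    (R.+-congˡ (R.trans (✶-cong {g = g} f′≋0 (λ _ → R.refl) n) (✶-zeroˡ g n))) (R.+-identityʳ _)

  commutativeSemiring : CommutativeSemiring c ℓ
  commutativeSemiring = record
    { _≈_ = _≋_ ; _+_ = _⊞_ ; _*_ = _✶_ ; 0# = ∅ ; 1# = ι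
    ; isCommutativeSemiring = IsCommutativeSemiringˡ.isCommutativeSemiring record
      { +-isCommutativeMonoid = Pointwise.isCommutativeMonoid ℕ R.+-isCommutativeMonoid
      ; *-isCommutativeMonoid = record
        { isMonoid = record
          { isSemigroup = record
            { isMagma = record
              { isEquivalence = Pointwise.isEquivalence ℕ R.isEquivalence
              ; ∙-cong        = ✶-cong
              }
            ; assoc = ✶-assoc
            }
          ; identity = ✶-identityˡ , λ f n → R.trans (✶-comm f ι n) (✶-identityˡ f n)
          }
        ; comm = ✶-comm
        }
      ; distribʳ = ✶-distribʳ
      ; zeroˡ    = ✶-zeroˡ
      }
    }

  -- Applied to the outer convolution, this turns a sum of power series in q into the nested integer
  -- sum that defines `_⊛_`.
  sum-coefficient : ∀ {m} (f : Fin m → PS) n →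
    Algebra.Properties.Semiring.Sum.sum (CommutativeSemiring.semiring commutativeSemiring) f n
      ≡ sumᴿ (λ i → f i n)
  sum-coefficient {zero}  f n = refl
  sum-coefficient {suc m} f n = cong (f zero n R.+_) (sum-coefficient (f ∘ suc) n)

-- The product of `Series` as an iterated convolution

open Algebra.Properties.Semiring.Sum ℤ.+-*-semiring using (sum-cong-≗)

module ℤ-Group = Algebra.Properties.Group (AbelianGroup.group ℤ.+-0-abelianGroup)

module ℤ⟦q⟧ = PowerSeries ℤ.+-*-commutativeSemiring
module ℤ⟦t,q⟧ = PowerSeries ℤ⟦q⟧.commutativeSemiring

⊛≈✶ : ∀ F G → F ⊛ G ≈ F ℤ⟦t,q⟧.✶ G
⊛≈✶ F G k n = sym (ℤ⟦q⟧.sum-coefficient {suc k} (λ i → F (toℕ i) ℤ⟦q⟧.✶ G (k ∸ toℕ i)) n)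

≈-trans : ∀ {F G H} → F ≈ G → G ≈ H → F ≈ H
≈-trans p r k n = trans (p k n) (r k n)

≈-sym : ∀ {F G} → F ≈ G → G ≈ F
≈-sym p k n = sym (p k n)

-- A coefficient of a product depends only on coefficients with both exponents at most as large. The
-- bounds allow infinite products to be replaced by truncations.
⊛-cong-≤ : ∀ {F F′ G G′} k n → (∀ i j → i ≤ k → j ≤ n → F i j ≡ F′ i j) →
           (∀ i j → i ≤ k → j ≤ n → G i j ≡ G′ i j) → (F ⊛ G) k n ≡ (F′ ⊛ G′) k n
⊛-cong-≤ k n p r = sum-cong-≗ {suc k} λ i → sum-cong-≗ {suc n} λ j →
  cong₂ ℤ._*_ (p (toℕ i) (toℕ j) (ℕ.≤-pred (Fin.toℕ<n i)) (ℕ.≤-pred (Fin.toℕ<n j)))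
              (r (k ∸ toℕ i) (n ∸ toℕ j) (ℕ.m∸n≤m k (toℕ i)) (ℕ.m∸n≤m n (toℕ j)))

⊛-cong : ∀ {F F′ G G′} → F ≈ F′ → G ≈ G′ → F ⊛ G ≈ F′ ⊛ G′
⊛-cong p r k n = ⊛-cong-≤ k n (λ i j _ _ → p i j) (λ i j _ _ → r i j)

⊛-congˡ : ∀ F {G G′} → G ≈ G′ → F ⊛ G ≈ F ⊛ G′
⊛-congˡ F = ⊛-cong {F} (λ _ _ → refl)

⊛-congʳ : ∀ G {F F′} → F ≈ F′ → F ⊛ G ≈ F′ ⊛ G
⊛-congʳ G p = ⊛-cong {G = G} p (λ _ _ → refl)

⊛-comm : ∀ F G → F ⊛ G ≈ G ⊛ F
⊛-comm F G = ≈-trans (⊛≈✶ F G) (≈-trans (ℤ⟦t,q⟧.✶-comm F G) (≈-sym (⊛≈✶ G F)))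

⊛-assoc : ∀ F G H → (F ⊛ G) ⊛ H ≈ F ⊛ (G ⊛ H)
⊛-assoc F G H =
  ≈-trans (⊛-congʳ H (⊛≈✶ F G)) (≈-trans (⊛≈✶ (F ℤ⟦t,q⟧.✶ G) H)
  (≈-trans (ℤ⟦t,q⟧.✶-assoc F G H) (≈-sym
  (≈-trans (⊛-congˡ F (⊛≈✶ G H)) (⊛≈✶ F (G ℤ⟦t,q⟧.✶ H))))))

one≈ι : one ≈ ℤ⟦t,q⟧.ι
one≈ι zero    zero    = refl
one≈ι zero    (suc n) = refl
one≈ι (suc k) n       = refl

⊛-identityˡ : ∀ F → one ⊛ F ≈ F
⊛-identityˡ F = ≈-trans (⊛-congʳ F one≈ι) (≈-trans (⊛≈✶ ℤ⟦t,q⟧.ι F) (ℤ⟦t,q⟧.✶-identityˡ F))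

⊛-distribʳ : ∀ H F G → (F ℤ⟦t,q⟧.⊞ G) ⊛ H ≈ (F ⊛ H) ℤ⟦t,q⟧.⊞ (G ⊛ H)
⊛-distribʳ H F G k n =
  trans (⊛≈✶ (F ℤ⟦t,q⟧.⊞ G) H k n) (trans (ℤ⟦t,q⟧.✶-distribʳ H F G k n)
  (cong₂ ℤ._+_ (sym (⊛≈✶ F H k n)) (sym (⊛≈✶ G H k n))))

⊛-commutativeMonoid : CommutativeMonoid _ _
⊛-commutativeMonoid = record
  { _≈_ = _≈_ ; _∙_ = _⊛_ ; ε = one
  ; isCommutativeMonoid = IsCommutativeMonoidˡ.isCommutativeMonoid record
    { isSemigroup = record
      { isMagma = record
        { isEquivalence = record
          { refl = λ _ _ → refl ; sym = ≈-sym ; trans = ≈-trans }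
        ; ∙-cong = ⊛-cong
        }
      ; assoc = ⊛-assoc
      }
    ; identityˡ = ⊛-identityˡ
    ; comm = ⊛-comm
    }
  }

-- Multiplication by monomials

shift : ℕ → ℕ → Series → Series
shift zero    zero    F k       n       = F k n
shift zero    (suc b) F k       zero    = 0ℤ
shift zero    (suc b) F k       (suc n) = shift zero b F k n
shift (suc a) b       F zero    n       = 0ℤ
shift (suc a) b       F (suc k) n       = shift a b F k n

-- A positive exponent makes the head of the monomial vanish, and its tail is by computation the
-- monomial with that exponent lowered by one; at exponent 0 the monomial is constant in that
-- variable. The recursion of `shift` has the same shape.
monomial-⊛ : ∀ a b F → monomial a b ⊛ F ≈ shift a b F
monomial-⊛ a b F k n = trans (⊛≈✶ (monomial a b) F k n) (go a b k n)
  where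
  go₀ : ∀ b k n → (monomial 0 b 0 ℤ⟦q⟧.✶ F k) n ≡ shift 0 b F k n
  go₀ zero    k n       = trans (ℤ⟦q⟧.✶-constant (monomial 0 0 0) (F k) n (λ _ → refl)) (ℤ.*-identityˡ (F k n))
  go₀ (suc b) k zero    = ℤ⟦q⟧.✶-zero-head (monomial 0 (suc b) 0) (F k) refl
  go₀ (suc b) k (suc n) = trans (ℤ⟦q⟧.✶-tail (monomial 0 (suc b) 0) (F k) n refl) (go₀ b k n)

  go : ∀ a b k n → (monomial a b ℤ⟦t,q⟧.✶ F) k n ≡ shift a b F k n
  go zero    b k       n = trans (ℤ⟦t,q⟧.✶-constant (monomial 0 b) F k (λ _ _ → refl) n) (go₀ b k n)
  go (suc a) b zero    n = ℤ⟦t,q⟧.✶-zero-head (monomial (suc a) b) F (λ _ → refl) n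
  go (suc a) b (suc k) n =
    trans (ℤ⟦t,q⟧.✶-tail (monomial (suc a) b) F k (λ _ → refl) n) (go a b k n)

shift-monomial : ∀ a b i j → shift a b (monomial i j) ≈ monomial (a + i) (b + j)
shift-monomial zero    zero    i j k n       = refl
shift-monomial zero    (suc b) i j k zero    =
  cong (λ x → if x then 1ℤ else 0ℤ) (sym (∧-zeroʳ (does (k ℕ.≟ i))))
shift-monomial zero    (suc b) i j k (suc n) = shift-monomial zero b i j k n
shift-monomial (suc a) b i j zero    n = refl
shift-monomial (suc a) b i j (suc k) n = shift-monomial a b i j k n

monomial-⊛-tq²^^ : ∀ i j N → monomial i j ⊛ tq² ^^ N ≈ monomial (i + N) (j + N * 2)
monomial-⊛-tq²^^ i j N = ≈-trans (⊛-congˡ (monomial i j) (power N))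
  (≈-trans (monomial-⊛ i j (monomial N (N * 2))) (shift-monomial i j N (N * 2)))
  where
  power : ∀ N → tq² ^^ N ≈ monomial N (N * 2)
  power zero    = λ _ _ → refl
  -- `tq² ^^ suc N` is `tq² ⊛ tq² ^^ N`, an instance of the enclosing statement at a smaller
  -- exponent.
  power (suc N) = monomial-⊛-tq²^^ 1 2 N

-- Adding monomial a b ⊛ F to either side gives F.
one⊖monomial-⊛ : ∀ a b {F G} → (∀ k n → F k n ≡ G k n ℤ.+ shift a b F k n) →
                 (one ⊖ monomial a b) ⊛ F ≈ G
one⊖monomial-⊛ a b {F} {G} eq k n = ℤ-Group.∙-cancelʳ _ _ _ (begin
  ((one ⊖ monomial a b) ⊛ F) k n ℤ.+ (monomial a b ⊛ F) k n
    ≡⟨ ⊛-distribʳ F (one ⊖ monomial a b) (monomial a b) k n ⟨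
  (((one ⊖ monomial a b) ℤ⟦t,q⟧.⊞ monomial a b) ⊛ F) k n
    ≡⟨ ⊛-congʳ F (λ i j → ℤ-Group.//-rightDividesˡ (monomial a b i j) (one i j)) k n ⟩
  (one ⊛ F) k n                            ≡⟨ ⊛-identityˡ F k n ⟩
  F k n                                    ≡⟨ eq k n ⟩
  G k n ℤ.+ shift a b F k n                ≡⟨ cong (ℤ._+_ (G k n)) (monomial-⊛ a b F k n) ⟨
  G k n ℤ.+ (monomial a b ⊛ F) k n         ∎)
  where open ≡-Reasoning

-- Telescoping products

module Regroup {c ℓ : Level} (M : CommutativeMonoid c ℓ) where
  open CommutativeMonoid M using (_∙_) renaming (_≈_ to _≈ₘ_; ε to e; refl to ≈ₘ-refl)
  open import Algebra.Solver.CommutativeMonoid M using (solve; _⊜_; _⊕_; id)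

  -- Proved in an arbitrary commutative monoid, so that the solver meets an opaque operation instead
  -- of the double sum `_⊛_`.
  regroup : ∀ f a a′ p p′ →
    f ∙ ((a ∙ p) ∙ ((a′ ∙ p′) ∙ e)) ≈ₘ (a ∙ (a′ ∙ f)) ∙ (p ∙ (p′ ∙ e))
  regroup = solve 5 (λ f a a′ p p′ →
    f ⊕ ((a ⊕ p) ⊕ ((a′ ⊕ p′) ⊕ id)) ⊜ (a ⊕ (a′ ⊕ f)) ⊕ (p ⊕ (p′ ⊕ id))) ≈ₘ-refl

-- Telescoping: the two factors of index `N` are moved next to `H (suc N)`, which they turn into
-- `H N`; at `N = 0` everything is `one`.
finitePochhammers-reciprocal : ∀ a a′ b (H : ℕ → Series) → H 0 ≈ one →
  (∀ N → (one ⊖ a ⊛ b ^^ N) ⊛ ((one ⊖ a′ ⊛ b ^^ N) ⊛ H (suc N)) ≈ H N) →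
  ∀ N → H N IsReciprocalOf (finitePochhammer a b N ⊛ (finitePochhammer a′ b N ⊛ one))
finitePochhammers-reciprocal a a′ b H H0 step zero    =
  ≈-trans (⊛-cong H0 (⊛-identityˡ (one ⊛ one))) (≈-trans (⊛-identityˡ _) (⊛-identityˡ one))
finitePochhammers-reciprocal a a′ b H H0 step (suc N) =
  ≈-trans (regroup (H (suc N)) (one ⊖ a ⊛ b ^^ N) (one ⊖ a′ ⊛ b ^^ N)
            (finitePochhammer a b N) (finitePochhammer a′ b N))
  (≈-trans (⊛-congʳ (finitePochhammer a b N ⊛ (finitePochhammer a′ b N ⊛ one)) (step N))
           (finitePochhammers-reciprocal a a′ b H H0 step N))
  where
  regroup : ∀ F A A′ P P′ →
    F ⊛ ((A ⊛ P) ⊛ ((A′ ⊛ P′) ⊛ one)) ≈ (A ⊛ (A′ ⊛ F)) ⊛ (P ⊛ (P′ ⊛ one))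
  regroup = Regroup.regroup ⊛-commutativeMonoid

pochhammers-reciprocal : ∀ a a′ b (H : ℕ → Series) F → b 0 0 ≡ 0ℤ →
  H 0 ≈ one → (∀ N → (one ⊖ a ⊛ b ^^ N) ⊛ ((one ⊖ a′ ⊛ b ^^ N) ⊛ H (suc N)) ≈ H N) →
  (∀ N k n → n ≤ N → H N k n ≡ F k n) →
  F IsReciprocalOf ⟨ a ∷ a′ ∷ [] ⨾ b ⟩∞
pochhammers-reciprocal a a′ b H F b00 H0 step H→F k n = trans
  (⊛-cong-≤ {F} {H N} {pochhammer a b ⊛ (pochhammer a′ b ⊛ one)} {P a ⊛ (P a′ ⊛ one)} k n
    (λ i j _ j≤n → sym (H→F N i j (ℕ.≤-trans j≤n n≤N)))
    λ i j i≤k j≤n → ⊛-cong-≤ {pochhammer a b} {P a} {pochhammer a′ b ⊛ one} {P a′ ⊛ one} i j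
      (λ i′ j′ i′≤i j′≤j → truncate a (ℕ.≤-trans i′≤i i≤k) (ℕ.≤-trans j′≤j j≤n))
      λ i′ j′ i′≤i j′≤j → ⊛-cong-≤ {pochhammer a′ b} {P a′} {one} {one} i′ j′
        (λ i″ j″ i″≤i′ j″≤j′ → truncate a′
          (ℕ.≤-trans i″≤i′ (ℕ.≤-trans i′≤i i≤k)) (ℕ.≤-trans j″≤j′ (ℕ.≤-trans j′≤j j≤n)))
        (λ _ _ _ _ → refl))
  (finitePochhammers-reciprocal a a′ b H H0 step N k n)
  where
  -- Large enough for all coefficients up to t^k q^n of both Pochhammer products to have stabilised,
  -- and at least `n`, so that `H N` agrees with `F` there.
  N : ℕ
  N = suc (k + n)
  P : Series → Series
  P a = finitePochhammer a b N
  n≤N : n ≤ N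
  n≤N = ℕ.m≤n⇒m≤1+n (ℕ.m≤n+m n k)
  truncate : ∀ a {i j} → i ≤ k → j ≤ n → pochhammer a b i j ≡ finitePochhammer a b N i j
  truncate a {i} {j} i≤k j≤n = sym (proj₂ (pochhammer-converges a b b00 i j) N (s≤s (ℕ.+-mono-≤ i≤k j≤n)))

-- Meanders of type λ / 1ⁿ

halfSum : List ℕ → ℕ
halfSum as = sum (map ⌊_/2⌋ as)

DisjointEdges : ∀ {n} → Fin n × Fin n → Fin n × Fin n → Set
DisjointEdges (u , v) (x , y) = (u ≢ x × u ≢ y) × (v ≢ x × v ≢ y)

-- The order rules out loops and makes the second end the larger vertex of its component. `AllPairs`
-- compares list positions, so parallel edges are excluded as well.
record IsMatching {n} (G : Multigraph n) : Set where
  field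
    ordered  : All (λ (u , v) → u Fin.< v) G
    disjoint : AllPairs DisjointEdges G

module _ {n} {e : Fin n × Fin n} where

  joins-ends : ∀ {v} → proj₁ e ≡ v → Joins e v (proj₂ e)
  joins-ends refl = inj₁ refl

  joins-functional : ∀ {u v w} → Joins e u v → Joins e u w → v ≡ w
  joins-functional (inj₁ refl) (inj₁ refl) = refl
  joins-functional (inj₁ refl) (inj₂ refl) = refl
  joins-functional (inj₂ refl) (inj₁ refl) = refl
  joins-functional (inj₂ refl) (inj₂ refl) = refl

  disjoint⇒¬joins : ∀ {e′ u v w} → DisjointEdges e e′ → Joins e u v → ¬ Joins e′ u w
  disjoint⇒¬joins ((p , _) , _) (inj₁ refl) (inj₁ refl) = p refl
  disjoint⇒¬joins ((_ , p) , _) (inj₁ refl) (inj₂ refl) = p refl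
  disjoint⇒¬joins (_ , (p , _)) (inj₂ refl) (inj₁ refl) = p refl
  disjoint⇒¬joins (_ , (_ , p)) (inj₂ refl) (inj₂ refl) = p refl

-- The conclusion concerns positions because routes and `Exhausts` refer to edges by position.
edge-unique : ∀ {n} {G : Multigraph n} → AllPairs DisjointEdges G → ∀ i j {u v w} →
              Joins (List.lookup G i) u v → Joins (List.lookup G j) u w → i ≡ j
edge-unique (d ∷ ds) zero    zero    p r = refl
edge-unique (d ∷ ds) zero    (suc j) p r =
  contradiction r (disjoint⇒¬joins (All.lookup d (∈-lookup j)) p)
edge-unique (d ∷ ds) (suc i) zero    p r =
  contradiction p (disjoint⇒¬joins (All.lookup d (∈-lookup i)) r)
edge-unique (d ∷ ds) (suc i) (suc j) p r = cong suc (edge-unique ds i j p r)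

module Matching {n} {G : Multigraph n} (matching : IsMatching G) where
  open IsMatching matching
  open DecMembership (Fin._≟_ {n}) using (_∈?_)

  adjacent-sym : ∀ {u v} → Adjacent G u v → Adjacent G v u
  adjacent-sym = Any.map swap

  joins-irreflexive : ∀ e {v} → ¬ Joins (List.lookup G e) v v
  joins-irreflexive e {v} p = Fin.<-irrefl refl (loop p (All.lookup ordered (∈-lookup e)))
    where
    loop : ∀ {x y} → Joins (x , y) v v → x Fin.< y → v Fin.< v
    loop (inj₁ refl) x<y = x<y
    loop (inj₂ refl) x<y = x<y

  adjacent-functional : ∀ {u v w} → Adjacent G u v → Adjacent G u w → v ≡ w
  adjacent-functional {u} {v} p r = joins-functional (lookup-index p)
    (subst (λ e → Joins (List.lookup G e) u _)
      (edge-unique disjoint (Any.index r) (Any.index p) (lookup-index r) (lookup-index p))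
      (lookup-index r))

  connected⇒adjacent : ∀ {u v} → Connected G u v → u ≡ v ⊎ Adjacent G u v
  connected⇒adjacent ε        = inj₁ refl
  connected⇒adjacent (s ◅ ss) with connected⇒adjacent ss
  ... | inj₁ refl = inj₂ s
  -- The vertex in between has only one neighbour, so the second step leads back to `u`.
  ... | inj₂ t    = inj₁ (adjacent-functional (adjacent-sym s) t)

  inPath : ∀ w → InPath G w
  inPath w with Fin.any? (λ v → Any.any? (λ e → joins? e w v) G)
  ... | no isolated = 0 , w , [] , [] , tt , [] ∷ [] , []
                    , (λ v → to , λ { (here refl) → ε })
                    , λ { e (here p) → contradiction
                            (_ , lose (∈-lookup e) (joins-ends p)) isolated }
    where
    to : ∀ {v} → Connected G w v → _
    to c with connected⇒adjacent c
    ... | inj₁ w≡v = here (sym w≡v)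
    ... | inj₂ a   = contradiction (_ , a) isolated
  ... | yes (v , w~v) = 1 , w , v ∷ [] , e ∷ [] , (e-joins , tt)
                      , (w≢v ∷ []) ∷ [] ∷ [] , [] ∷ []
                      , (λ x → to , λ { (here refl) → ε ; (there (here refl)) → w~v ◅ ε })
                      -- An edge that starts at `w` or at `v` shares this vertex with `e`, hence is
                      -- `e`.
                      , λ { e′ (here p) → here (edge-unique disjoint e′ e (joins-ends p) e-joins)
                          ; e′ (there (here p)) →
                              here (edge-unique disjoint e′ e (joins-ends p) (swap e-joins)) }
    where
    e : Edge G
    e = Any.index w~v
    e-joins : Joins (List.lookup G e) w v
    e-joins = lookup-index w~v
    w≢v : w ≢ v
    w≢v refl = joins-irreflexive e e-joins
    to : ∀ {x} → Connected G w x → _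
    to c with connected⇒adjacent c
    ... | inj₁ w≡x = here (sym w≡x)
    ... | inj₂ a   = there (here (adjacent-functional a w~v))

  -- A cycle of length 1 would be a loop; a longer one enters and leaves its first listed vertex by
  -- two different edges, which a matching forbids.
  ¬inCycle : ∀ w → ¬ InCycle G w
  ¬inCycle w (zero  , v ∷ [] , e ∷ [] , (e-joins , _) , _) = joins-irreflexive e e-joins
  ¬inCycle w (suc _ , _ ∷ _ ∷ _ , e ∷ e′ ∷ _ , (p , p′ , _) , _ , ((e≢e′ ∷ _) ∷ _) , _) =
    e≢e′ (edge-unique disjoint e e′ (swap p) p′)

  least⇒∉ends : ∀ {w} → Least G w → w ∉ map proj₂ G
  least⇒∉ends least w∈ with ∈-map⁻ proj₂ w∈
  ... | (v , _) , vw∈G , refl =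
    ℕ.<⇒≱ (All.lookup ordered vw∈G) (least v (lose vw∈G (inj₂ refl) ◅ ε))

  ∉ends⇒least : ∀ {w} → w ∉ map proj₂ G → Least G w
  ∉ends⇒least {w} w∉ v c with connected⇒adjacent c
  ... | inj₁ refl = ℕ.≤-refl
  ... | inj₂ a    = go (lookup-index a) (∈-lookup (Any.index a))
    where
    go : ∀ {e} → Joins e w v → e ∈ G → w Fin.≤ v
    go (inj₁ refl) e∈G = ℕ.<⇒≤ (All.lookup ordered e∈G)
    go (inj₂ refl) e∈G = contradiction (∈-map⁺ proj₂ e∈G) w∉

  #cycles≡0 : #cycles G ≡ 0
  #cycles≡0 = cong length
    (filter-none (λ w → least? G w ×-dec inCycle? G w) {xs = allFin n}
      (All.tabulate⁺ λ w → λ { (_ , c) → ¬inCycle w c }))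

  -- Every component is an isolated vertex or a single edge, so the vertices
  -- that are not least in their components are the larger ends of the edges.
  length+#paths : length G + #paths G ≡ n
  length+#paths = begin
    length G + #paths G              ≡⟨ cong (_+ #paths G) (length-map proj₂ G) ⟨
    length (map proj₂ G) + #paths G  ≡⟨ length-++ (map proj₂ G) ⟨
    length (map proj₂ G ++ roots)    ≡⟨ ↭-length (∼bag⇒↭ (unique∧set⇒bag
                                          unique (Unique.allFin⁺ n) (mk⇔ (λ _ → ∈-allFin _) (λ _ → covers _)))) ⟩
    length (allFin n)                ≡⟨ length-tabulate _ ⟩
    n                                ∎
    where
    open ≡-Reasoning
    P? = λ w → least? G w ×-dec inPath? G w
    roots : List (Fin n)
    roots = filter P? (allFin n)
    unique : Unique (map proj₂ G ++ roots)
    unique = Unique.++⁺ (AllPairs.map⁺ (AllPairs.map (λ d → proj₂ (proj₂ d)) disjoint))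
      (Unique.filter⁺ P? (Unique.allFin⁺ n))
      (λ (w∈ends , w∈roots) →
        least⇒∉ends (proj₁ (proj₂ (∈-filter⁻ P? {xs = allFin n} w∈roots))) w∈ends)
    covers : ∀ w → w ∈ map proj₂ G ++ roots
    covers w with w ∈? map proj₂ G
    ... | yes w∈ = ∈-++⁺ˡ w∈
    ... | no w∉  = ∈-++⁺ʳ (map proj₂ G) (∈-filter⁺ P? (∈-allFin w) (∉ends⇒least w∉ , inPath w))

-- The arcs of a composition form a matching

StrictlyMonotone : ∀ {m n} → (Fin m → Fin n) → Set
StrictlyMonotone f = ∀ {i j} → i Fin.< j → f i Fin.< f j

-- All relabellings in a meander, `_↑ˡ_`, `_↑ʳ_` and `cast`, add a constant to the position.
toℕ-preserving⇒monotone : ∀ {m n} (f : Fin m → Fin n) a → (∀ i → toℕ (f i) ≡ a + toℕ i) →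
                          StrictlyMonotone f
toℕ-preserving⇒monotone f a eq {i} {j} i<j =
  subst₂ _<_ (sym (eq i)) (sym (eq j)) (ℕ.+-monoʳ-< a i<j)

monotone⇒≢ : ∀ {m n} {f : Fin m → Fin n} → StrictlyMonotone f → ∀ {i j} → i ≢ j → f i ≢ f j
monotone⇒≢ mono {i} {j} i≢j with Fin.<-cmp i j
... | tri< i<j _ _ = Fin.<⇒≢ (mono i<j)
... | tri≈ _ i≡j _ = contradiction i≡j i≢j
... | tri> _ _ j<i = ≢-sym (Fin.<⇒≢ (mono j<i))

mapEdges-isMatching : ∀ {m n} {f : Fin m → Fin n} → StrictlyMonotone f →
                      ∀ {G} → IsMatching G → IsMatching (mapEdges f G)
mapEdges-isMatching mono M = record
  { ordered  = All.map⁺ (All.map mono ordered)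
  ; disjoint = AllPairs.map⁺ (AllPairs.map
      (λ ((a , b) , (c , d)) → (≢-f a , ≢-f b) , (≢-f c , ≢-f d)) disjoint)
  }
  where
  open IsMatching M
  ≢-f = monotone⇒≢ mono

blockArcs-isMatching : ∀ a → IsMatching (blockArcs a)
blockArcs-isMatching a = record
  { ordered  = All.tabulate⁺ (λ j → left<right j j)
  ; disjoint = AllPairs.tabulate⁺ λ {i} {j} i≢j →
      (left≢left i≢j , Fin.<⇒≢ (left<right i j)) ,
      (≢-sym (Fin.<⇒≢ (left<right j i)) , left≢left i≢j ∘ opposite-injective)
  }
  where
  left : Fin ⌊ a /2⌋ → Fin a
  left j = inject≤ j (ℕ.⌊n/2⌋≤n a)

  left≢left : ∀ {i j} → i ≢ j → left i ≢ left j
  left≢left i≢j = i≢j ∘ Fin.inject≤-injective _ _ _ _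

  opposite-injective : ∀ {i j : Fin a} → opposite i ≡ opposite j → i ≡ j
  opposite-injective {i} {j} eq = trans (sym (Fin.opposite-involutive i))
    (trans (cong opposite eq) (Fin.opposite-involutive j))

  -- Left ends lie in the first half of the block and right ends in the second. Equal indices give
  -- the order within an arc, different ones separate the left end of one arc from the right end of
  -- another.
  left<right : ∀ i j → left i Fin.< opposite (left j)
  left<right i j = begin-strict
    toℕ (left i)              ≡⟨ Fin.toℕ-inject≤ i _ ⟩
    toℕ i                     <⟨ Fin.toℕ<n i ⟩
    ⌊ a /2⌋                   ≤⟨ ℕ.⌊n/2⌋≤⌈n/2⌉ a ⟩
    ⌈ a /2⌉                   ≡⟨ ℕ.m+n∸m≡n ⌊ a /2⌋ ⌈ a /2⌉ ⟨
    ⌊ a /2⌋ + ⌈ a /2⌉ ∸ ⌊ a /2⌋ ≡⟨ cong (_∸ ⌊ a /2⌋) (ℕ.⌊n/2⌋+⌈n/2⌉≡n a) ⟩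
    a ∸ ⌊ a /2⌋               ≤⟨ ℕ.∸-monoʳ-≤ a (Fin.toℕ<n j) ⟩
    a ∸ suc (toℕ j)           ≡⟨ cong (λ x → a ∸ suc x) (Fin.toℕ-inject≤ j _) ⟨
    a ∸ suc (toℕ (left j))    ≡⟨ Fin.opposite-prop (left j) ⟨
    toℕ (opposite (left j))   ∎
    where open ℕ.≤-Reasoning

arcs-isMatching : ∀ as → IsMatching (arcs as)
arcs-isMatching []       = record { ordered = [] ; disjoint = [] }
arcs-isMatching (a ∷ as) = record
  { ordered  = All.++⁺ (ordered left) (ordered right)
  ; disjoint = AllPairs.++⁺ (disjoint left) (disjoint right)
      (All.map⁺ (All.universal (λ (u , v) → All.map⁺ (All.universal (λ (x , y) →
        (ˡ≢ʳ u x , ˡ≢ʳ u y) , (ˡ≢ʳ v x , ˡ≢ʳ v y)) (arcs as))) (blockArcs a)))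
  }
  where
  open IsMatching
  left : IsMatching (mapEdges (_↑ˡ sum as) (blockArcs a))
  left = mapEdges-isMatching
    (toℕ-preserving⇒monotone (_↑ˡ sum as) 0 (λ i → Fin.toℕ-↑ˡ i (sum as))) (blockArcs-isMatching a)
  right : IsMatching (mapEdges (a ↑ʳ_) (arcs as))
  right = mapEdges-isMatching
    (toℕ-preserving⇒monotone (a ↑ʳ_) a (Fin.toℕ-↑ʳ a)) (arcs-isMatching as)
  ˡ≢ʳ : ∀ (i : Fin a) (j : Fin (sum as)) → i ↑ˡ sum as ≢ a ↑ʳ j
  ˡ≢ʳ i j = Fin.<⇒≢ (subst₂ _<_ (sym (Fin.toℕ-↑ˡ i (sum as))) (sym (Fin.toℕ-↑ʳ a j))
    (ℕ.<-≤-trans (Fin.toℕ<n i) (ℕ.m≤m+n a (toℕ j))))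

length-arcs : ∀ as → length (arcs as) ≡ halfSum as
length-arcs []       = refl
length-arcs (a ∷ as) = trans (length-++ (mapEdges (_↑ˡ sum as) (blockArcs a)))
  (cong₂ _+_ (trans (length-map _ (blockArcs a)) (length-tabulate _))
             (trans (length-map _ (arcs as)) (length-arcs as)))

arcs-ones : ∀ n → arcs (replicate n 1) ≡ []
arcs-ones zero    = refl
arcs-ones (suc n) = cong (mapEdges (1 ↑ʳ_)) (arcs-ones n)

module _ {n} (α : Composition n) where
  open Composition α

  meander-ones : meander α (ones n) ≡ mapEdges (cast sum≡n) (arcs parts)
  meander-ones = trans
    (cong (λ G → mapEdges (cast sum≡n) (arcs parts) ++ mapEdges (cast (Composition.sum≡n (ones n))) G)
          (arcs-ones n))
    (++-identityʳ _)

  meander-ones-isMatching : IsMatching (meander α (ones n))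
  meander-ones-isMatching = subst IsMatching (sym meander-ones) (mapEdges-isMatching
    (toℕ-preserving⇒monotone (cast sum≡n) 0 (Fin.toℕ-cast sum≡n)) (arcs-isMatching parts))

  #paths-meander-ones : halfSum parts + #paths (meander α (ones n)) ≡ n
  #paths-meander-ones = trans
    (cong (_+ #paths (meander α (ones n))) (sym (trans (cong length meander-ones)
      (trans (length-map _ (arcs parts)) (length-arcs parts)))))
    (Matching.length+#paths meander-ones-isMatching)

  #cycles-meander-ones : #cycles (meander α (ones n)) ≡ 0
  #cycles-meander-ones = Matching.#cycles≡0 meander-ones-isMatching

-- Partitions by largest part

length-filter-map : ∀ {A B : Set} {P : Pred B 0ℓ} (P? : Decidable P) (f : A → B) xs →
                    length (filter P? (map f xs)) ≡ length (filter (P? ∘ f) xs)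
length-filter-map P? f []       = refl
length-filter-map P? f (x ∷ xs) with does (P? (f x))
... | true  = cong suc (length-filter-map P? f xs)
... | false = length-filter-map P? f xs

-- Removing a part lowers the fuel by one but the sum by the whole part, whereas `count` always
-- starts with fuel equal to the sum.
bounded-fuel : ∀ l l′ m n → n ≤ l → n ≤ l′ → bounded l m n ≡ bounded l′ m n
bounded-fuel l       l′       m       zero    _         _          = refl
bounded-fuel l       l′       zero    (suc n) _         _          = refl
bounded-fuel (suc l) (suc l′) (suc m) (suc n) (s≤s n≤l) (s≤s n≤l′) =
  cong₂ (λ xss yss → xss ++ (if m ≤ᵇ n then map (suc m ∷_) yss else []))
    (bounded-fuel (suc l) (suc l′) m (suc n) (s≤s n≤l) (s≤s n≤l′))
    (bounded-fuel l l′ (suc m) (n ∸ m) (ℕ.≤-trans (ℕ.m∸n≤m n m) n≤l) (ℕ.≤-trans (ℕ.m∸n≤m n m) n≤l′))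

-- A bound above `n` admits no further part; `_≤′_` lowers it one step at a time.
bounded-large : ∀ {l m n} → n ≤′ m → bounded l m n ≡ bounded l n n
bounded-large                         (≤′-reflexive refl) = refl
bounded-large {l}     {_}     {zero}  (≤′-step n≤′m)      = refl
bounded-large {zero}  {_}     {suc n} (≤′-step n≤′m)      = refl
bounded-large {suc l} {suc m} {suc n} (≤′-step n≤′m)      with m ≤ᵇ n in eq
... | true  = contradiction (ℕ.≤ᵇ⇒≤ m n (subst T (sym eq) tt)) (ℕ.<⇒≱ (ℕ.≤′⇒≤ n≤′m))
... | false = trans (++-identityʳ (bounded (suc l) m (suc n))) (bounded-large n≤′m)

Counted : ℕ → ℕ → Pred (List ℕ) _
Counted s k xs = All (s <_) xs × halfSum xs ≡ k

counted? : ∀ s k → Decidable (Counted s k)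
counted? s k xs = All.all? (s ℕ.<?_) xs ×-dec (halfSum xs ℕ.≟ k)

count : ℕ → ℕ → ℕ → ℕ → ℕ
count s m n k = length (filter (counted? s k) (bounded n m n))

shift-≤ : ∀ {a b} F {k n} → a ≤ k → b ≤ n → shift a b F k n ≡ F (k ∸ a) (n ∸ b)
shift-≤ {zero}  {zero}  F _         _         = refl
shift-≤ {zero}  {suc b} F _         (s≤s b≤n) = shift-≤ {0} {b} F z≤n b≤n
shift-≤ {suc a} {b}     F (s≤s a≤k) b≤n       = shift-≤ {a} {b} F a≤k b≤n

shift-< : ∀ {a b} F {k n} → k < a → shift a b F k n ≡ 0ℤ
shift-< {suc a} {b} F {zero}  _         = refl
shift-< {suc a} {b} F {suc k} (s≤s k<a) = shift-< {a} {b} F k<a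

shift-<ʳ : ∀ {a b} F {k n} → n < b → shift a b F k n ≡ 0ℤ
shift-<ʳ {zero}  {suc b} F {k}     {zero}  _         = refl
shift-<ʳ {zero}  {suc b} F {k}     {suc n} (s≤s n<b) = shift-<ʳ {0} {b} F n<b
shift-<ʳ {suc a} {b}     F {zero}  {n}     n<b       = refl
shift-<ʳ {suc a} {b}     F {suc k} {n}     n<b       = shift-<ʳ {a} {b} F n<b

length-filter-counted-∷ : ∀ {s m k} xss → s ≤ m → ⌊ suc m /2⌋ ≤ k →
  length (filter (counted? s k) (map (suc m ∷_) xss))
    ≡ length (filter (counted? s (k ∸ ⌊ suc m /2⌋)) xss)
length-filter-counted-∷ {s} {m} {k} xss s≤m h≤k = trans
  (length-filter-map (counted? s k) (suc m ∷_) xss)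
  (cong length (filter-≐ (counted? s k ∘ (suc m ∷_)) (counted? s (k ∸ h)) (to , from) xss))
  where
  h : ℕ
  h = ⌊ suc m /2⌋
  to : ∀ {xs} → Counted s k (suc m ∷ xs) → Counted s (k ∸ h) xs
  to {xs} (_ ∷ all , eq) = all , trans (sym (ℕ.m+n∸m≡n h (halfSum xs))) (cong (_∸ h) eq)
  from : ∀ {xs} → Counted s (k ∸ h) xs → Counted s k (suc m ∷ xs)
  from (all , eq) = s≤s s≤m ∷ all , trans (cong (_+_ h) eq) (ℕ.m+[n∸m]≡n h≤k)

filter-counted-∷-none : ∀ {s m k} xss → k < ⌊ suc m /2⌋ →
                        filter (counted? s k) (map (suc m ∷_) xss) ≡ []
filter-counted-∷-none {s} {m} {k} xss k<h = filter-none (counted? s k)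
  (All.map⁺ (All.universal
    (λ xs (_ , eq) → ℕ.<⇒≱ k<h (ℕ.≤-trans (ℕ.m≤m+n _ (halfSum xs)) (ℕ.≤-reflexive eq))) xss))

-- Either suc m is not a part, or removing one copy of it leaves a partition of
-- the same kind.
count-suc : ∀ {s m} → s ≤ m → ∀ k n →
  generatingSeries (count s (suc m)) k n
    ≡ generatingSeries (count s m) k n
      ℤ.+ shift ⌊ suc m /2⌋ (suc m) (generatingSeries (count s (suc m))) k n
count-suc {s} {m} s≤m k zero    = sym (trans
  (cong (ℤ._+_ (+ count s m 0 k)) (shift-<ʳ {⌊ suc m /2⌋} _ (s≤s z≤n))) (ℤ.+-identityʳ _))
count-suc {s} {m} s≤m k (suc n) = begin
  + length (filter P? (without ++ with-part))
    ≡⟨ cong (+_ ∘ length) (filter-++ P? without with-part) ⟩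
  + length (filter P? without ++ filter P? with-part)
    ≡⟨ cong +_ (length-++ (filter P? without)) ⟩
  + length (filter P? without) ℤ.+ + length (filter P? with-part)
    ≡⟨ cong (ℤ._+_ (+ length (filter P? without))) shifted ⟩
  + length (filter P? without) ℤ.+ shift h (suc m) S k (suc n) ∎
  where
  open ≡-Reasoning
  h : ℕ
  h = ⌊ suc m /2⌋
  S : Series
  S = generatingSeries (count s (suc m))
  P? = counted? s k
  rest without with-part : List (List ℕ)
  rest = bounded n (suc m) (n ∸ m)
  without = bounded (suc n) m (suc n)
  with-part = if m ≤ᵇ n then map (suc m ∷_) rest else []

  shifted : + length (filter P? with-part) ≡ shift h (suc m) S k (suc n)
  -- The cases follow `shift`: both exponents suffice, the exponent of t is too small, the exponent
  -- of q is too small.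
  shifted with m ≤ᵇ n in eq | h ℕ.≤? k
  ... | true  | yes h≤k = begin
    + length (filter P? (map (suc m ∷_) rest))       ≡⟨ cong +_ (length-filter-counted-∷ rest s≤m h≤k) ⟩
    + length (filter (counted? s (k ∸ h)) rest)
      ≡⟨ cong (+_ ∘ length ∘ filter (counted? s (k ∸ h)))
              (bounded-fuel n (n ∸ m) (suc m) (n ∸ m) (ℕ.m∸n≤m n m) ℕ.≤-refl) ⟩
    S (k ∸ h) (n ∸ m)                                ≡⟨ shift-≤ S h≤k (s≤s m≤n) ⟨
    shift h (suc m) S k (suc n)                      ∎
    where
    m≤n : m ≤ n
    m≤n = ℕ.≤ᵇ⇒≤ m n (subst T (sym eq) tt)
  ... | true  | no h≰k = trans (cong (+_ ∘ length) (filter-counted-∷-none {s} rest (ℕ.≰⇒> h≰k)))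
                               (sym (shift-< S (ℕ.≰⇒> h≰k)))
  ... | false | _      = sym (shift-<ʳ {h} S (s≤s (ℕ.≰⇒> λ m≤n → subst T eq (ℕ.≤⇒≤ᵇ m≤n))))

-- A part would have to be at most `s` and larger than `s`, so only the empty partition survives.
-- This is where the telescoping ends.
count-empty : ∀ s → generatingSeries (count s s) ≈ one
count-empty s zero    zero    = refl
count-empty s (suc k) zero    = refl
count-empty s k       (suc n) = trans
  (cong (+_ ∘ length) (filter-none (counted? s k) (All.map none (bounded-sound (suc n) s (suc n)))))
  (cong (λ x → if x then 1ℤ else 0ℤ) (sym (∧-zeroʳ (does (k ℕ.≟ 0)))))
  where
  none : ∀ {xs} → IsBounded s (suc n) xs → ¬ Counted s k xs
  none {[]}    (_ , _ , _ , ())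
  none {_ ∷ _} (x≤s ∷ _ , _) (s<x ∷ _ , _) = ℕ.<⇒≱ s<x x≤s

count-stable : ∀ {s m n} k → n ≤ m → count s m n k ≡ count s n n k
count-stable {s} k n≤m = cong (length ∘ filter (counted? s k)) (bounded-large (ℕ.≤⇒≤′ n≤m))

-- Part sizes and Pochhammer factors

⌊n*2/2⌋ : ∀ n → ⌊ n * 2 /2⌋ ≡ n
⌊n*2/2⌋ zero    = refl
⌊n*2/2⌋ (suc n) = cong suc (⌊n*2/2⌋ n)

⌊1+n*2/2⌋ : ∀ n → ⌊ suc (n * 2) /2⌋ ≡ n
⌊1+n*2/2⌋ zero    = refl
⌊1+n*2/2⌋ (suc n) = cong suc (⌊1+n*2/2⌋ n)

one⊖-cong : ∀ {F G} → F ≈ G → one ⊖ F ≈ one ⊖ G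
one⊖-cong p k n = cong (ℤ._-_ (one k n)) (p k n)

-- In base tq² the factor of index `N` contains t^(i + N) q^(j + 2N); the two equations identify
-- this monomial with the contribution of one part `suc m`.
count-removes-part : ∀ i j N {s m} → s ≤ m → i + N ≡ ⌊ suc m /2⌋ → j + N * 2 ≡ suc m →
  (one ⊖ monomial i j ⊛ tq² ^^ N) ⊛ generatingSeries (count s (suc m)) ≈ generatingSeries (count s m)
count-removes-part i j N {s} {m} s≤m i+N≡h j+2N≡1+m = ≈-trans
  (⊛-congʳ S (one⊖-cong (≈-trans (monomial-⊛-tq²^^ i j N)
    λ k n → cong₂ (λ a b → monomial a b k n) i+N≡h j+2N≡1+m)))
  (one⊖monomial-⊛ ⌊ suc m /2⌋ (suc m) (count-suc s≤m))
  where
  S : Series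
  S = generatingSeries (count s (suc m))

-- For s = 0 this applies to c and for s = 1 to c̃: H N counts the partitions with
-- all parts in (s , s + 2N], and passing from H N to H (suc N) allows two more
-- part sizes, one of either parity.
module _ (s i j i′ j′ : ℕ)
         (first-step  : ∀ N → i + N ≡ ⌊ suc (s + N * 2) /2⌋ × j + N * 2 ≡ suc (s + N * 2))
         (second-step : ∀ N → i′ + N ≡ ⌊ 2 + (s + N * 2) /2⌋ × j′ + N * 2 ≡ 2 + (s + N * 2))
  where

  private
    H : ℕ → Series
    H N = generatingSeries (count s (s + N * 2))

    s+[1+N]*2 : ∀ N → s + suc N * 2 ≡ 2 + (s + N * 2)
    s+[1+N]*2 N = trans (ℕ.+-suc s (suc (N * 2))) (cong suc (ℕ.+-suc s (N * 2)))

    step : ∀ N → (one ⊖ monomial i j ⊛ tq² ^^ N) ⊛ ((one ⊖ monomial i′ j′ ⊛ tq² ^^ N) ⊛ H (suc N)) ≈ H N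
    -- The inner factor removes the part `2 + (s + N * 2)`, the outer one then removes the part just
    -- below it.
    step N = ≈-trans
      (⊛-congˡ (one ⊖ monomial i j ⊛ tq² ^^ N) (≈-trans
        (⊛-congˡ (one ⊖ monomial i′ j′ ⊛ tq² ^^ N) λ k n → cong (λ m → + count s m n k) (s+[1+N]*2 N))
        (count-removes-part i′ j′ N (ℕ.m≤n⇒m≤1+n (ℕ.m≤m+n s (N * 2)))
          (proj₁ (second-step N)) (proj₂ (second-step N)))))
      (count-removes-part i j N (ℕ.m≤m+n s (N * 2)) (proj₁ (first-step N)) (proj₂ (first-step N)))

  count-reciprocal : ∀ f → (∀ n k → f n k ≡ count s n n k) →
    generatingSeries f IsReciprocalOf ⟨ monomial i j ∷ monomial i′ j′ ∷ [] ⨾ tq² ⟩∞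
  count-reciprocal f f≡count = pochhammers-reciprocal (monomial i j) (monomial i′ j′) tq² H
    (generatingSeries f) refl
    (λ k n → trans (cong (λ m → + count s m n k) (ℕ.+-identityʳ s)) (count-empty s k n))
    step
    (λ N k n n≤N → cong +_ (trans
      (count-stable k (ℕ.≤-trans n≤N (ℕ.≤-trans (ℕ.m≤m*n N 2) (ℕ.m≤n+m (N * 2) s))))
      (sym (f≡count n k))))

-- The two statistics

-- Moves a count from `Partition` records to the lists produced by `bounded`, where the recursion is
-- available.
length-filter-partitions : ∀ {n} {P : Pred (Partition n) 0ℓ} {Q : Pred (List ℕ) 0ℓ}
  (P? : Decidable P) (Q? : Decidable Q) → P ≐ (Q ∘ Partition.parts) →
  length (filter P? (partitions n)) ≡ length (filter Q? (bounded n n n))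
length-filter-partitions {n} P? Q? P≐Q = begin
  length (filter P? (partitions n))
    ≡⟨ cong length (filter-≐ P? (Q? ∘ Partition.parts) P≐Q (partitions n)) ⟩
  length (filter (Q? ∘ Partition.parts) (partitions n))
    ≡⟨ length-filter-map Q? Partition.parts (partitions n) ⟨
  length (filter Q? (map Partition.parts (partitions n)))
    ≡⟨ cong (length ∘ filter Q?) (partitions-parts n) ⟩
  length (filter Q? (bounded n n n)) ∎
  where open ≡-Reasoning

index-matching : ∀ {C P h n} → C ≡ 0 → h + P ≡ n →
                 + 2 ℤ.* + C ℤ.+ + P ℤ.- 1ℤ ≡ + n ℤ.- + h ℤ.- 1ℤ
index-matching {P = P} {h} refl refl = cong (ℤ._- 1ℤ) (begin
  + P                     ≡⟨ ℤ-Group.//-rightDividesʳ (+ h) (+ P) ⟨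
  + (P + h) ℤ.- + h       ≡⟨ cong (λ x → + x ℤ.- + h) (ℕ.+-comm P h) ⟩
  + (h + P) ℤ.- + h       ∎)
  where open ≡-Reasoning

-- A separate statement, so that the decision procedures inside #cycles and
-- #paths are not normalised in ind-ones.
ind-unfold : ∀ {n} (μ α : Composition n) →
  ind μ α ≡ + 2 ℤ.* + #cycles (meander α μ) ℤ.+ + #paths (meander α μ) ℤ.- 1ℤ
ind-unfold μ α = refl

ind-ones : ∀ {n} (α : Composition n) →
           ind (ones n) α ≡ + n ℤ.- + halfSum (Composition.parts α) ℤ.- 1ℤ
ind-ones {n} α = trans (ind-unfold (ones n) α)
  (index-matching (#cycles-meander-ones α) (#paths-meander-ones α))

index-injective : ∀ n {h k} → + n ℤ.- + h ℤ.- 1ℤ ≡ + n ℤ.- + k ℤ.- 1ℤ → h ≡ k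
index-injective n {h} {k} eq = ℤ.+-injective (ℤ.neg-injective
  (ℤ-Group.∙-cancelˡ (+ n) (ℤ.- + h) (ℤ.- + k)
    (ℤ-Group.∙-cancelʳ (ℤ.- 1ℤ) (+ n ℤ.- + h) (+ n ℤ.- + k) eq)))

c≡count : ∀ n k → c n k ≡ count 0 n n k
c≡count n k = length-filter-partitions
  (λ π → ind (ones n) (Partition.composition π) ℤ.≟ + n ℤ.- + k ℤ.- 1ℤ) (counted? 0 k)
  ((λ {π} → to π) , λ {π} → from π)
  where
  to : ∀ (π : Partition n) → ind (ones n) (Partition.composition π) ≡ + n ℤ.- + k ℤ.- 1ℤ →
       Counted 0 k (Partition.parts π)
  -- For `s = 0` the lower bound on the parts is their positivity.
  to π eq = Partition.positive π ,
    index-injective n (trans (sym (ind-ones (Partition.composition π))) eq)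
  from : ∀ (π : Partition n) → Counted 0 k (Partition.parts π) →
         ind (ones n) (Partition.composition π) ≡ + n ℤ.- + k ℤ.- 1ℤ
  from π (_ , eq) = trans (ind-ones (Partition.composition π)) (cong (λ h → + n ℤ.- + h ℤ.- 1ℤ) eq)

-- The weight as a sum of halved parts

indicator : ℕ → ℕ → ℕ
indicator i j = if does (i ℕ.≟ j) then 1 else 0

multiplicity : List ℕ → ℕ → ℕ
multiplicity xs i = length (filter (i ℕ.≟_) xs)

multiplicity-∷ : ∀ x xs i → multiplicity (x ∷ xs) i ≡ indicator i x + multiplicity xs i
multiplicity-∷ x xs i with does (i ℕ.≟ x)
... | true  = refl
... | false = refl

sum-applyUpTo-cong : ∀ {f g} → f ≗ g → ∀ n → sum (applyUpTo f n) ≡ sum (applyUpTo g n)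
sum-applyUpTo-cong f≗g zero    = refl
sum-applyUpTo-cong f≗g (suc n) = cong₂ _+_ (f≗g 0) (sum-applyUpTo-cong (f≗g ∘ suc) n)

sum-applyUpTo-+ : ∀ (f g : ℕ → ℕ) n →
  sum (applyUpTo (λ j → f j + g j) n) ≡ sum (applyUpTo f n) + sum (applyUpTo g n)
sum-applyUpTo-+ f g zero    = refl
sum-applyUpTo-+ f g (suc n) = trans
  (cong (_+_ (f 0 + g 0)) (sum-applyUpTo-+ (f ∘ suc) (g ∘ suc) n)) (+-interchange (f 0) (g 0) _ _)

sum-applyUpTo-0 : ∀ {f} → (∀ j → f j ≡ 0) → ∀ n → sum (applyUpTo f n) ≡ 0
sum-applyUpTo-0 f≡0 zero    = refl
sum-applyUpTo-0 f≡0 (suc n) = cong₂ _+_ (f≡0 0) (sum-applyUpTo-0 (f≡0 ∘ suc) n)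

sum-applyUpTo-indicator : ∀ f {h n} → h < n → sum (applyUpTo (λ j → f j * indicator j h) n) ≡ f h
sum-applyUpTo-indicator f {zero}  (s≤s {n = n} _) = trans
  (cong₂ _+_ (ℕ.*-identityʳ (f 0)) (sum-applyUpTo-0 (λ j → ℕ.*-zeroʳ (f (suc j))) n))
  (ℕ.+-identityʳ (f 0))
sum-applyUpTo-indicator f {suc h} (s≤s h<n) =
  cong₂ _+_ (ℕ.*-zeroʳ (f 0)) (sum-applyUpTo-indicator (f ∘ suc) h<n)

-- Exactly the numbers 2i and 2i + 1 have half `i` when rounded down. The induction lowers `x` by
-- two and `i` by one.
indicator-half : ∀ i x → indicator (2 * i) x + indicator (2 * i + 1) x ≡ indicator i ⌊ x /2⌋
indicator-half zero    zero          = refl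
indicator-half zero    (suc zero)    = refl
indicator-half zero    (suc (suc x)) = refl
indicator-half (suc i) zero          = refl
-- The rewriting exposes two successors in `2 * suc i`, so that the comparison with `x` computes.
indicator-half (suc i) (suc zero)    rewrite ℕ.+-suc i (i + 0) = refl
indicator-half (suc i) (suc (suc x)) rewrite ℕ.+-suc i (i + 0) = indicator-half i x

-- In `weight` the cut-off is the size of the partition; here it is a separate argument, which stays
-- fixed while parts are removed.
weightOf : List ℕ → ℕ → ℕ
weightOf xs n = sum (applyUpTo
  (λ j → suc j * (multiplicity xs (2 * suc j) + multiplicity xs (2 * suc j + 1))) n)

-- The sum over the j < n of suc j * indicator (suc j) ⌊ x /2⌋ is the sum over the
-- j ≤ n of j * indicator j ⌊ x /2⌋, as the term j = 0 is 0.
weightOf-∷ : ∀ x xs n → ⌊ x /2⌋ ≤ n → weightOf (x ∷ xs) n ≡ ⌊ x /2⌋ + weightOf xs n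
weightOf-∷ x xs n h≤n = begin
  weightOf (x ∷ xs) n
    ≡⟨ sum-applyUpTo-cong split n ⟩
  sum (applyUpTo (λ j → suc j * indicator (suc j) ⌊ x /2⌋ + suc j * m (suc j)) n)
    ≡⟨ sum-applyUpTo-+ (λ j → suc j * indicator (suc j) ⌊ x /2⌋) (λ j → suc j * m (suc j)) n ⟩
  sum (applyUpTo (λ j → suc j * indicator (suc j) ⌊ x /2⌋) n) + weightOf xs n
    ≡⟨ cong (_+ weightOf xs n) (sum-applyUpTo-indicator (λ j → j) (s≤s h≤n)) ⟩
  ⌊ x /2⌋ + weightOf xs n ∎
  where
  open ≡-Reasoning
  m : ℕ → ℕ
  m i = multiplicity xs (2 * i) + multiplicity xs (2 * i + 1)
  split : ∀ j → suc j * (multiplicity (x ∷ xs) (2 * suc j) + multiplicity (x ∷ xs) (2 * suc j + 1))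
              ≡ suc j * indicator (suc j) ⌊ x /2⌋ + suc j * m (suc j)
  split j = trans (cong (_*_ (suc j)) (begin
    multiplicity (x ∷ xs) (2 * i) + multiplicity (x ∷ xs) (2 * i + 1)
      ≡⟨ cong₂ _+_ (multiplicity-∷ x xs (2 * i)) (multiplicity-∷ x xs (2 * i + 1)) ⟩
    (indicator (2 * i) x + multiplicity xs (2 * i)) + (indicator (2 * i + 1) x + multiplicity xs (2 * i + 1))
      ≡⟨ +-interchange (indicator (2 * i) x) (multiplicity xs (2 * i)) (indicator (2 * i + 1) x) (multiplicity xs (2 * i + 1)) ⟩
    (indicator (2 * i) x + indicator (2 * i + 1) x) + m i
      ≡⟨ cong (_+ m i) (indicator-half i x) ⟩
    indicator i ⌊ x /2⌋ + m i ∎)) (ℕ.*-distribˡ-+ i (indicator i ⌊ x /2⌋) (m i))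
    where
    i : ℕ
    i = suc j

weightOf≡halfSum : ∀ xs n → sum xs ≤ n → weightOf xs n ≡ halfSum xs
weightOf≡halfSum []       n _   = sum-applyUpTo-0 (λ j → ℕ.*-zeroʳ (suc j)) n
weightOf≡halfSum (x ∷ xs) n s≤n = trans
  (weightOf-∷ x xs n (ℕ.≤-trans (ℕ.⌊n/2⌋≤n x) (ℕ.m+n≤o⇒m≤o x s≤n)))
  (cong (_+_ ⌊ x /2⌋) (weightOf≡halfSum xs n (ℕ.m+n≤o⇒n≤o x s≤n)))

multiplicity-1≡0⇒ : ∀ {xs} → All (0 <_) xs → multiplicity xs 1 ≡ 0 → All (1 <_) xs
multiplicity-1≡0⇒ []                              _  = []
multiplicity-1≡0⇒ {suc zero    ∷ _} (_ ∷ _)       ()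
multiplicity-1≡0⇒ {suc (suc x) ∷ _} (_ ∷ positive) eq = s≤s (s≤s z≤n) ∷ multiplicity-1≡0⇒ positive eq

c̃≡count : ∀ n k → c̃ n k ≡ count 1 n n k
c̃≡count n k = length-filter-partitions
  (λ π → (mult π 1 ℕ.≟ 0) ×-dec (weight π ℕ.≟ k)) (counted? 1 k)
  ((λ {π} → to π) , λ {π} → from π)
  where
  weight≡ : ∀ (π : Partition n) → weight π ≡ halfSum (Partition.parts π)
  weight≡ π = weightOf≡halfSum (Partition.parts π) n (ℕ.≤-reflexive (Partition.sum≡n π))
  to : ∀ (π : Partition n) → mult π 1 ≡ 0 × weight π ≡ k → Counted 1 k (Partition.parts π)
  to π (no-ones , eq) = multiplicity-1≡0⇒ (Partition.positive π) no-ones , trans (sym (weight≡ π)) eq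
  from : ∀ (π : Partition n) → Counted 1 k (Partition.parts π) → mult π 1 ≡ 0 × weight π ≡ k
  from π (1< , eq) = cong length (filter-none (1 ℕ.≟_) (All.map ℕ.<⇒≢ 1<)) , trans (weight≡ π) eq

theorem4 : (generatingSeries c IsReciprocalOf ⟨ q ∷ tq² ∷ [] ⨾ tq² ⟩∞) ×
    (generatingSeries c̃ IsReciprocalOf ⟨ tq² ∷ tq³ ∷ [] ⨾ tq² ⟩∞)
theorem4 =
  -- After `s` come the exponents of t and q in `q` and in `tq²`; the factors of index N belong to
  -- the parts 2N + 1 and 2N + 2.
  count-reciprocal 0 0 1 1 2 (λ N → sym (⌊1+n*2/2⌋ N) , refl)
    (λ N → cong suc (sym (⌊n*2/2⌋ N)) , refl) c c≡count ,
  -- With `s = 1` the parities trade places: `tq²` belongs to the parts 2N + 2 and `tq³` to the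
  -- parts 2N + 3.
  count-reciprocal 1 1 2 1 3 (λ N → cong suc (sym (⌊n*2/2⌋ N)) , refl)
    (λ N → cong suc (sym (⌊1+n*2/2⌋ N)) , refl) c̃ c̃≡count
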